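{- Let $n,m,t,a,r$ be positive integers with $m\ge 2$, $t\ge 3$, $2\le a\le \min\{m,t-1\}$ and $r=mt-a$. Define $$d:=\left\lceil\frac{(m-1)(r-1)n}{mt-2}\right\rceil,\qquad s:=\left\lfloor\frac{d}{m-1}\right\rfloor,\qquad T:=d-(m-1)s\in\{0,\dots,m-2\},$$ $$H:=n+td+(t-2)s-rn.$$ Then $$\delta(n,r,t)=(r-1)n-d-\varepsilon,$$ where $\varepsilon\in\{0,1\}$ is given by $$\varepsilon=\begin{cases}1,& H<0,\\ 1,& H=0\text{ and }(n-s)\nmid T,\\ 0,&\text{otherwise.}\end{cases}$$ Equivalently, $\min_A D(A)=d+\varepsilon$, where the minimum is over all $r\times t$ nonnegative integer matrices $A$ all of whose row sums equal $n$.
   Context: A balanced $r$-partite graph with parts of size $n$ is a simple graph whose vertex set is partitioned into $r$ independent sets $V_1,\dots,V_r$, each of size $n$. $\delta(G)$ denotes the minimum degree of $G$ and $\chi(G)$ its chromatic number. For positive integers $n,r,t$, $$\delta(n,r,t)=\max\{\delta(G): G\text{ is balanced }r\text{ -partite with parts of size }n\text{ and }\chi(G)\le t\}.$$ For an $r\times t$ nonnegative integer matrix $A=(a_{ij})$ with all row sums equal to $n$, let $c_j=\sum_{i=1}^r a_{ij}$ be its $j$th column sum, and let $$D(A)=\max\{c_j-a_{ij}: 1\le i\le r,\ 1\le j\le t,\ a_{ij}>0\}.$$ -}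

module Defs where

open import Algebra.Properties.CommutativeMonoid.Sum using (sum)
open import Data.Bool.Base using (if_then_else_)
open import Data.Fin.Base using (Fin)
open import Data.Fin.Properties using () renaming (_≟_ to _≟ᶠ_)
open import Data.Integer.Base as ℤ using (ℤ; +_; 0ℤ; 1ℤ)
open import Data.Integer.Divisibility.Signed using (_∣?_)
open import Data.Integer.Properties as ℤ using ()
open import Data.Nat.Base using (ℕ; _+_; _*_; _∸_; _≤_; _<_; NonZero; >-nonZero)
open import Data.Nat.Properties using (+-0-commutativeMonoid; *-mono-≤; ≤-trans; m<n⇒0<n∸m; _≤?_)
open import Data.Product.Base using (∃; ∃₂; _×_; Σ-syntax)
open import Data.Rational.Unnormalised.Base using (_/_; floor; ceiling)
open import Data.Vec.Base using (allFin; count)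
open import Level using (0ℓ)
open import Relation.Binary.Core using (Rel)
open import Relation.Binary.Definitions using (Decidable; Irreflexive; Symmetric)
open import Relation.Binary.PropositionalEquality.Core using (_≡_; _≢_)
open import Relation.Nullary using (does; ¬_)
open import Relation.Nullary.Decidable using (¬?; _×-dec_; from-yes)
open import Relation.Unary using (Pred)

IsMaximum : ∀ {ℓ} → Pred ℕ ℓ → Pred ℕ ℓ
IsMaximum P k = P k × (∀ {j} → P j → j ≤ k)

IsMinimum : ∀ {ℓ} → Pred ℕ ℓ → Pred ℕ ℓ
IsMinimum P k = P k × (∀ {j} → P j → k ≤ j)

record SimpleGraph (order : ℕ) : Set₁ where
  field
    _~_    : Rel (Fin order) 0ℓ
    _~?_   : Decidable _~_
    sym    : Symmetric _~_
    irrefl : Irreflexive _≡_ _~_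

  degree : Fin order → ℕ
  degree v = count (v ~?_) (allFin order)

  -- IsMinDegree k is δ(G) = k.  Here and below a quantity given by an extremum
  -- is the relation holding of its value, if the extremum exists.
  IsMinDegree : Pred ℕ 0ℓ
  IsMinDegree = IsMinimum λ k → ∃ λ v → degree v ≡ k

  Colourable : Pred ℕ 0ℓ
  Colourable k = Σ[ c ∈ (Fin order → Fin k) ] (∀ {u v} → u ~ v → c u ≢ c v)

  -- χ(G) = k
  IsChromaticNumber : Pred ℕ 0ℓ
  IsChromaticNumber = IsMinimum Colourable

record BalancedPartiteGraph (r n : ℕ) : Set₁ where
  field
    order       : ℕ
    graph       : SimpleGraph order
    part        : Fin order → Fin r
    part-size   : ∀ i → count (λ v → part v ≟ᶠ i) (allFin order) ≡ n
  open SimpleGraph graph public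
  field
    independent : ∀ {u v} → part u ≡ part v → ¬ (u ~ v)

-- δ(n,r,t) = k
IsMaxMinDegree : (n r t : ℕ) → ℕ → Set₁
IsMaxMinDegree n r t = IsMaximum λ k →
  Σ[ G ∈ BalancedPartiteGraph r n ]
    (∃ λ χ → BalancedPartiteGraph.IsChromaticNumber G χ × χ ≤ t)
    × BalancedPartiteGraph.IsMinDegree G k

Matrix : (r t : ℕ) → Set
Matrix r t = Fin r → Fin t → ℕ

Σᶠ : ∀ {k} → (Fin k → ℕ) → ℕ
Σᶠ = sum +-0-commutativeMonoid

rowSum : ∀ {r t} → Matrix r t → Fin r → ℕ
rowSum A i = Σᶠ λ j → A i j

columnSum : ∀ {r t} → Matrix r t → Fin t → ℕ
columnSum A j = Σᶠ λ i → A i j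

-- D(A) = k; the truncated subtraction is exact, since A i j is a summand of
-- its column sum.
IsD : ∀ {r t} → Matrix r t → Pred ℕ 0ℓ
IsD A = IsMaximum λ k → ∃₂ λ i j → 0 < A i j × columnSum A j ∸ A i j ≡ k

-- min D(A) = k over the r × t matrices A with all row sums n
IsMinD : (n r t : ℕ) → Pred ℕ 0ℓ
IsMinD n r t = IsMinimum λ k →
  Σ[ A ∈ Matrix r t ] (∀ i → rowSum A i ≡ n) × IsD A k

-- The bounds on m and t serve to make the two denominators nonzero (and the
-- truncated subtractions in them exact).
module Parameters (n r : ℕ) {m t : ℕ} (2≤m : 2 ≤ m) (3≤t : 3 ≤ t) where

  private instance
    m∸1≢0 : NonZero (m ∸ 1)
    m∸1≢0 = >-nonZero (m<n⇒0<n∸m 2≤m)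

    mt∸2≢0 : NonZero (m * t ∸ 2)
    mt∸2≢0 = >-nonZero (m<n⇒0<n∸m
      (≤-trans (from-yes (3 ≤? 6)) (*-mono-≤ 2≤m 3≤t)))

  d s T H : ℤ
  d = ceiling (((+ m ℤ.- 1ℤ) ℤ.* (+ r ℤ.- 1ℤ) ℤ.* + n) / (m * t ∸ 2))
  s = floor (d / (m ∸ 1))
  T = d ℤ.- (+ m ℤ.- 1ℤ) ℤ.* s
  H = + n ℤ.+ + t ℤ.* d ℤ.+ (+ t ℤ.- + 2) ℤ.* s ℤ.- + r ℤ.* + n

  ε : ℤ
  ε = if does (H ℤ.<? 0ℤ) then 1ℤ else
      if does ((H ℤ.≟ 0ℤ) ×-dec ¬? ((+ n ℤ.- s) ∣? T)) then 1ℤ else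
      0ℤ

{-# OPTIONS --safe #-}

-- Call A bounded by D when every positive entry of a column of sum c is at least
-- c − D, that is, D(A) ≤ D.  A column with k positive entries then has c ≤ k n
-- and k (c − D) ≤ c.  If a row has two positive entries then their columns have
-- total at most 2 D + n, and otherwise all positive entries are n; comparing the
-- sum of the columns with r n gives D ≥ d, and gives H ≥ 0 if D = d.  If D = d
-- and H = 0 all these bounds are tight, and any column apart from the two has sum
-- d + s = m s + T.  It cannot have fewer than m positive entries; if it has more,
-- then n = s + 1; if it has m of them, each is s or n, whence n − s ∣ T.
-- For the converse, give t − 1 columns m rows each, with entries s, or s + h in g
-- of them where g h = T; the remaining column receives the rest of these rows,
-- and m − a further rows completely.  Take h = 1, or h = n − s if H = 0.  Finally,
-- a t-coloured balanced r-partite graph has a matrix counting part i in colour j,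
-- whose D bounds the minimum degree, with equality if all pairs of vertices of
-- different part and colour are adjacent.
module Submission where

open import Defs
open import Algebra.Properties.CommutativeMonoid.Sum as Sum using ()
open import Algebra.Properties.Semiring.Sum as SemiringSum using ()
open import Data.Bool.Base using (if_then_else_; true; false)
open import Data.Empty using (⊥; ⊥-elim)
open import Data.Fin.Base using (Fin; zero; suc; punchIn; punchOut; splitAt; remQuot; toℕ; combine; inject≤; finToFun; funToFin; _↑ˡ_; _↑ʳ_)
open import Data.Fin.Properties using (any?; all?; punchIn-punchOut; punchInᵢ≢i; splitAt-↑ˡ; splitAt-↑ʳ; remQuot-combine; inject≤-injective; finToFun-funToFin) renaming (_≟_ to _≟ᶠ_)
open import Data.Integer.Base as ℤ using (ℤ; +_; -[1+_]; +≤+; 0ℤ; 1ℤ)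
import Data.Integer.DivMod as ℤ
import Data.Integer.Properties as ℤ
open import Data.Integer.Divisibility.Signed as Signed using (∣⇒∣ᵤ; ∣ᵤ⇒∣)
open import Data.Integer.Tactic.RingSolver using () renaming (solve-∀ to ℤ-solve-∀)
open import Data.Nat.Base
open import Data.Nat.Divisibility using (_∣_; divides; _∣?_)
open import Data.Nat.DivMod using (m≡m%n+[m/n]*n; m%n<n)
open import Data.Nat.Properties
open import Data.Nat.Tactic.RingSolver using (solve-∀)
open import Data.Product.Base using (Σ-syntax; ∃; ∃₂; _×_; _,_; proj₁; proj₂; uncurry)
open import Data.Rational.Unnormalised.Base using (floor; ceiling) renaming (_/_ to _/ᵘ_)
open import Data.Sum.Base using (_⊎_; inj₁; inj₂; [_,_]′; map₂)
open import Data.Vec.Base using (tabulate; count)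
open import Data.Vec.Functional using (removeAt)
open import Function.Base using (_∘_; id)
open import Relation.Binary.Definitions using (tri<; tri≈; tri>)
open import Relation.Binary.PropositionalEquality using (_≡_; _≢_; refl; sym; trans; cong; cong₂; subst; subst₂; module ≡-Reasoning)
open import Relation.Nullary using (Dec; yes; no; does; ¬_; contradiction)
open import Relation.Nullary.Decidable using (¬?; _×-dec_; _→-dec_; map′; decidable-stable)
open import Relation.Unary using (Pred; Decidable)
open Sum +-0-commutativeMonoid using (sum-remove; sum-cong-≗; ∑-comm; ∑-distrib-+)
open SemiringSum +-*-semiring using (*-distribˡ-sum)

-- Linear arithmetic

-- The equation says that y - x is (q - p) + z. With p ≤ q a nonnegative combination of the
-- hypotheses and `z` the remaining slack, it is a polynomial identity that the ring solver checks.
≤-certificate : ∀ {p q x y} z → p ≤ q → q + (x + z) ≡ p + y → x ≤ y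
≤-certificate {p} {q} {x} {y} z p≤q eq = ≤-trans (m≤m+n x z) (+-cancelˡ-≤ p _ _ (begin
  p + (x + z) ≤⟨ +-monoˡ-≤ (x + z) p≤q ⟩
  q + (x + z) ≡⟨ eq ⟩
  p + y       ∎))
  where open ≤-Reasoning

-- Dual form: the hypotheses and the negated goal combine to p ≤ q, although identically p exceeds q
-- by at least one.
≤-refutation : ∀ {p q} z → p ≤ q → p ≡ q + suc z → ⊥
≤-refutation z p≤q refl = m+1+n≰m _ p≤q

-- m = 2 + N, a = 2 + β and t = 3 + β + c remove all subtractions: M is m − 1, τ is
-- t − 2, K is m t − 2 and R is r − 1.  The inequalities below are certified by sums
-- of multiples of their hypotheses.
module Arithmetic (N β c : ℕ) where
  M τ t K R : ℕ
  M = suc N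
  τ = suc (β + c)
  t = 2 + τ
  K = M * t + τ
  R = M * t + c

  -- K - R = 1 + β, so M R n ≤ M K n ≤ D K.
  single-bound : ∀ n D → M * n ≤ D → M * R * n ≤ D * K
  single-bound n D h = ≤-certificate (M * n * suc β) (*-monoˡ-≤ K h) (eq N β c n D)
    where
    eq : ∀ N β c n D → let M = 1 + N; τ = 1 + (β + c); t = 2 + τ; R = M * t + c in
      D * (M * t + τ) + (M * R * n + M * n * (1 + β)) ≡ M * n * (M * t + τ) + D * (M * t + τ)
    eq = solve-∀

  -- 2 M + τ (M + 1) = M t + τ = K: two columns have total at most 2 D + n, and M times each of the
  -- other τ is at most (M + 1) D. This is the origin of the denominator m t - 2.
  double-bound : ∀ n D → M * (suc R * n) ≤ M * (2 * D + n) + τ * (suc M * D) → M * R * n ≤ D * K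
  double-bound n D h = ≤-certificate 0 h (eq N β c n D)
    where
    eq : ∀ N β c n D → let M = 1 + N; τ = 1 + (β + c); t = 2 + τ; R = M * t + c in
      M * (2 * D + n) + τ * ((1 + M) * D) + (M * R * n + 0) ≡ M * ((1 + R) * n) + D * (M * t + τ)
    eq = solve-∀

  -- Cancelling τ M n from the first inequality leaves 2 M n + c n ≤ 2 D, so M n ≤ D, against the
  -- second.
  double-refutation : ∀ n D → M * (suc R * n) ≤ M * (2 * D + n) + τ * (M * (M * n)) →
                      ¬ (suc M * D < M * (M * n))
  double-refutation n D h₁ h₂ =
    ≤-refutation (2 * N + 1 + M * n * (M * (2 + c) + c))
      (+-mono-≤ (*-monoʳ-≤ (suc M) h₁) (*-monoʳ-≤ (2 * M) h₂)) (eq N β c n D)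
    where
    eq : ∀ N β c n D → let M = 1 + N; τ = 1 + (β + c); t = 2 + τ; R = M * t + c in
      (1 + M) * (M * ((1 + R) * n)) + 2 * M * (1 + (1 + M) * D)
      ≡ (1 + M) * (M * (2 * D + n) + τ * (M * (M * n))) + 2 * M * (M * (M * n))
        + (1 + (2 * N + 1 + M * n * (M * (2 + c) + c)))
    eq = solve-∀

  -- As r = R + 1, the terms n and -r n of H combine to -R n. Hence H is `H₊` - `H₋`, and its sign
  -- is a comparison in ℕ.
  module Estimates (n s T : ℕ) (1≤n : 1 ≤ n) (T<M : T < M) where
    private
      d H₊ H₋ : ℕ
      d = M * s + T
      H₊ = t * d + τ * s
      H₋ = R * n

    -- From T ≤ M - 1, M (d + s) ≥ (M + 1) d - (M - 1). Since (M + 1) R exceeds M K by 2 M + (M + 1)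
    -- c, the hypothesis makes (M + 1) d at least M (M n), and the rounding loses less than one.
    Mn≤d+s : M * R * n ≤ d * K → M * n ≤ d + s
    Mn≤d+s lo with M * n ≤? d + s
    ... | yes p = p
    ... | no ¬p = ⊥-elim (≤-refutation (M * n * (M * (2 + c) + c) + (M * t + β + c))
      (+-mono-≤ (+-mono-≤ (*-monoʳ-≤ (suc M) lo) (*-monoʳ-≤ (K * M) (≰⇒> ¬p))) (*-monoʳ-≤ K (s≤s⁻¹ T<M)))
      (eq N β c n s T))
      where
      eq : ∀ N β c n s T → let M = 1 + N; τ = 1 + (β + c); t = 2 + τ; R = M * t + c; K = M * t + τ; d = M * s + T in
        (1 + M) * (M * R * n) + K * M * (1 + (d + s)) + K * T
        ≡ (1 + M) * (d * K) + K * M * (M * n) + K * N + (1 + (M * n * (M * (2 + c) + c) + (M * t + β + c)))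
      eq = solve-∀

    Mn≤d⇒n≤s : M * n ≤ d → n ≤ s
    Mn≤d⇒n≤s h with n ≤? s
    ... | yes p = p
    ... | no ¬p = ⊥-elim (≤-refutation 0
      (+-mono-≤ (+-mono-≤ (*-monoʳ-≤ M (≰⇒> ¬p)) h) (s≤s⁻¹ T<M)) (eq N n s T))
      where
      eq : ∀ N n s T → let M = 1 + N in
        M * (1 + s) + M * n + T ≡ M * n + (M * s + T) + N + 1
      eq = solve-∀

    -- Here also n ≤ s, so `H₊` is at least (t M + τ) n = K n, and K - R = 1 + β is positive.
    Mn≤d⇒H>0 : M * n ≤ d → H₋ < H₊
    Mn≤d⇒H>0 h = ≤-certificate (β * n)
      (+-mono-≤ (+-mono-≤ (*-monoʳ-≤ t h) (*-monoʳ-≤ τ (Mn≤d⇒n≤s h))) 1≤n) (eq N β c n s T)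
      where
      eq : ∀ N β c n s T → let M = 1 + N; τ = 1 + (β + c); t = 2 + τ; R = M * t + c; K = M * t + τ; d = M * s + T in
        t * d + τ * s + n + ((1 + R * n) + β * n) ≡ t * (M * n) + τ * n + 1 + (t * d + τ * s)
      eq = solve-∀

    double⇒H≥0 : suc R * n ≤ 2 * d + n + τ * (d + s) → H₋ ≤ H₊
    double⇒H≥0 h = ≤-certificate 0 h (eq N β c n s d)
      where
      eq : ∀ N β c n s d → let M = 1 + N; τ = 1 + (β + c); t = 2 + τ; R = M * t + c in
        2 * d + n + τ * (d + s) + (R * n + 0) ≡ (1 + R) * n + (t * d + τ * s)
      eq = solve-∀

    -- M s ≥ d - (M - 1) gives M H ≥ -τ (M - 1) > -M t. So raising d by one makes H positive, even
    -- with s unchanged.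
    H₊<H₋+t : M * R * n ≤ d * K → H₋ < t * suc d + τ * s
    H₊<H₋+t lo with H₋ <? t * suc d + τ * s
    ... | yes p = p
    ... | no ¬p = ⊥-elim (≤-refutation (2 * N + 1 + τ)
      (+-mono-≤ (+-mono-≤ (*-monoʳ-≤ M (≮⇒≥ ¬p)) lo) (*-monoʳ-≤ τ (s≤s⁻¹ T<M))) (eq N β c n s T))
      where
      eq : ∀ N β c n s T → let M = 1 + N; τ = 1 + (β + c); t = 2 + τ; R = M * t + c; K = M * t + τ; d = M * s + T in
        M * (t * (1 + d) + τ * s) + M * R * n + τ * T ≡ M * (R * n) + d * K + τ * N + (1 + (2 * N + 1 + τ))
      eq = solve-∀

    module _ (lo : M * R * n ≤ d * K) (H≡0 : H₊ ≡ H₋) where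

      -- H = 0 reads t (d + s) = M t n + c n + 2 s. If d + s ≤ M n, then s = 0, so d = T < M ≤ M n,
      -- against `Mn≤d+s`.
      Mn<d+s : M * n < d + s
      Mn<d+s = ≰⇒> λ d+s≤Mn → ≤-refutation (suc M * (s + c * n))
        (+-mono-≤ (+-mono-≤ (+-mono-≤ (*-monoʳ-≤ M 1≤n) (s≤s⁻¹ T<M)) (Mn≤d+s lo))
          (*-monoʳ-≤ (suc M) (+-mono-≤ (*-monoʳ-≤ t d+s≤Mn) (≤-reflexive (sym H≡0)))))
        (eq N β c n s T)
        where
        eq : ∀ N β c n s T → let M = 1 + N; τ = 1 + (β + c); t = 2 + τ; R = M * t + c; d = M * s + T in
          M * 1 + T + M * n + (1 + M) * (t * (d + s) + R * n)
          ≡ M * n + N + (d + s) + (1 + M) * (t * (M * n) + (t * d + τ * s)) + (1 + (1 + M) * (s + c * n))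
        eq = solve-∀

      -- The hypothesis amounts to s ≤ T ≤ M - 1, and H = 0 reads R n = K s + t T. If n ≥ s + 2,
      -- then 2 R ≤ (1 + β) s + t T, which is below 2 t M because 1 + β < t; but R ≥ M t.
      overfull⇒n≤s+1 : (2 + M) * s ≤ d + s → n ≤ suc s
      overfull⇒n≤s+1 h = ≮⇒≥ λ 2+s≤n → ≤-refutation ((2 + c) * N + 2 * β + 4 * c + 5)
        (+-mono-≤ (+-mono-≤ (+-mono-≤ (*-monoʳ-≤ R 2+s≤n) (≤-reflexive (sym H≡0)))
          (*-monoʳ-≤ (suc β + t) (s≤s⁻¹ T<M))) (*-monoʳ-≤ (suc β) h))
        (eq N β c n s T)
        where
        eq : ∀ N β c n s T → let M = 1 + N; τ = 1 + (β + c); t = 2 + τ; R = M * t + c; d = M * s + T in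
          R * (2 + s) + R * n + (1 + β + t) * T + (1 + β) * ((2 + M) * s)
          ≡ R * n + (t * d + τ * s) + (1 + β + t) * N + (1 + β) * (d + s)
            + (1 + ((2 + c) * N + 2 * β + 4 * c + 5))
        eq = solve-∀

-- Finite sums

private variable k : ℕ

Σ-mono-≤ : {f g : Fin k → ℕ} → (∀ i → f i ≤ g i) → Σᶠ f ≤ Σᶠ g
Σ-mono-≤ {k = zero}  f≤g = z≤n
Σ-mono-≤ {k = suc k} f≤g = +-mono-≤ (f≤g zero) (Σ-mono-≤ (f≤g ∘ suc))

Σ-const : ∀ k {x} → Σᶠ {k} (λ _ → x) ≡ k * x
Σ-const zero    = refl
Σ-const (suc k) = cong (_+_ _) (Σ-const k)

Σ-≤-const : {f : Fin k → ℕ} {B : ℕ} → (∀ i → f i ≤ B) → Σᶠ f ≤ k * B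
Σ-≤-const {k = k} f≤B = ≤-trans (Σ-mono-≤ f≤B) (≤-reflexive (Σ-const k))

f≤Σ : (f : Fin k → ℕ) (i : Fin k) → f i ≤ Σᶠ f
f≤Σ {k = suc k} f i = ≤-trans (m≤m+n (f i) _) (≤-reflexive (sym (sum-remove f)))

Σ>0⇒∃ : {f : Fin k → ℕ} → 0 < Σᶠ f → ∃ λ i → 0 < f i
Σ>0⇒∃ {k = suc k} {f} Σ>0 with f zero in eq
... | zero  = let i , fi>0 = Σ>0⇒∃ Σ>0 in suc i , fi>0
... | suc _ = zero , subst (0 <_) (sym eq) z<s

Σ>const⇒∃ : {f : Fin k → ℕ} {B : ℕ} → k * B < Σᶠ f → ∃ λ i → B < f i
Σ>const⇒∃ {f = f} {B} kB<Σ with any? (λ i → B <? f i)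
... | yes p = p
... | no ¬p = contradiction (Σ-≤-const (λ i → ≮⇒≥ λ B<fi → ¬p (i , B<fi))) (<⇒≱ kB<Σ)

others : {i j : Fin (2 + k)} → i ≢ j → Fin k → Fin (2 + k)
others {i = i} i≢j l = punchIn i (punchIn (punchOut i≢j) l)

Σ-remove₂ : (f : Fin (2 + k) → ℕ) {i j : Fin (2 + k)} (i≢j : i ≢ j) →
            Σᶠ f ≡ f i + (f j + Σᶠ (f ∘ others i≢j))
Σ-remove₂ f {i} {j} i≢j = trans (sum-remove {i = i} f) (cong (_+_ (f i))
  (trans (sum-remove {i = punchOut i≢j} (removeAt f i))
    (cong (λ l → f l + Σᶠ (f ∘ others i≢j)) (punchIn-punchOut i≢j))))

f+f≤Σ : (f : Fin k → ℕ) {i j : Fin k} → i ≢ j → f i + f j ≤ Σᶠ f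
f+f≤Σ {k = suc zero}    f {zero} {zero} i≢j = contradiction refl i≢j
f+f≤Σ {k = suc (suc k)} f {i} {j} i≢j = begin
  f i + f j                              ≤⟨ +-monoʳ-≤ (f i) (m≤m+n (f j) _) ⟩
  f i + (f j + Σᶠ (f ∘ others i≢j))      ≡⟨ Σ-remove₂ f i≢j ⟨
  Σᶠ f                                   ∎
  where open ≤-Reasoning

-- The number of nonzero entries; `1 ⊓_` computes once `f zero` is matched, as the inductions below
-- require.
support : (Fin k → ℕ) → ℕ
support f = Σᶠ λ i → 1 ⊓ f i

Σ≤support* : {f : Fin k → ℕ} {u : ℕ} → (∀ i → f i ≤ u) → Σᶠ f ≤ support f * u
Σ≤support* {k = zero} f≤u = z≤n
Σ≤support* {k = suc k} {f} {u} f≤u with f zero | f≤u zero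
... | zero  | _ = Σ≤support* (f≤u ∘ suc)
... | suc x | p = +-mono-≤ p (Σ≤support* (f≤u ∘ suc))

support*≤Σ : {f : Fin k → ℕ} {u : ℕ} → (∀ i → 0 < f i → u ≤ f i) → support f * u ≤ Σᶠ f
support*≤Σ {k = zero} u≤f = z≤n
support*≤Σ {k = suc k} {f} u≤f with f zero | u≤f zero
... | zero  | _ = support*≤Σ (u≤f ∘ suc)
... | suc x | p = +-mono-≤ (p z<s) (support*≤Σ (u≤f ∘ suc))

-- `p` counts the positive entries that were found to be s + e. With s + e = n this yields the
-- divisibility by n - s.
Σ-two-valued : {f : Fin k → ℕ} (s e : ℕ) →
               (∀ i → 0 < f i → f i ≡ s ⊎ f i ≡ s + e) →
               ∃ λ p → Σᶠ f ≡ support f * s + p * e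
Σ-two-valued {k = zero} s e _ = 0 , refl
Σ-two-valued {k = suc k} {f} s e two with Σ-two-valued {f = f ∘ suc} s e (two ∘ suc)
... | p , eq with f zero | two zero
...   | zero  | _ = p , eq
...   | suc x | q with q z<s
...     | inj₁ x≡s = p , trans (cong₂ _+_ x≡s eq) (lemma s (support (f ∘ suc)) p e)
  where
  lemma : ∀ s k p e → s + (k * s + p * e) ≡ (1 + k) * s + p * e
  lemma = solve-∀
...     | inj₂ x≡s+e = suc p , trans (cong₂ _+_ x≡s+e eq) (lemma s (support (f ∘ suc)) p e)
  where
  lemma : ∀ s k p e → s + e + (k * s + p * e) ≡ (1 + k) * s + (1 + p) * e
  lemma = solve-∀

Σ-single : {f : Fin k → ℕ} (i : Fin k) → (∀ j → j ≢ i → f j ≡ 0) → Σᶠ f ≡ f i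
Σ-single {k = suc k} {f} i zeros = begin
  Σᶠ f                                ≡⟨ sum-remove {i = i} f ⟩
  f i + Σᶠ (λ j → f (punchIn i j))    ≡⟨ cong (_+_ (f i)) (sum-cong-≗ λ j → zeros (punchIn i j) (punchInᵢ≢i i j)) ⟩
  f i + Σᶠ {k} (λ _ → 0)              ≡⟨ cong (_+_ (f i)) (trans (Σ-const k) (*-zeroʳ k)) ⟩
  f i + 0                             ≡⟨ +-identityʳ (f i) ⟩
  f i                                 ∎
  where open ≡-Reasoning

Σ-↑ : ∀ p {q} (f : Fin (p + q) → ℕ) → Σᶠ f ≡ Σᶠ (λ i → f (i ↑ˡ q)) + Σᶠ (λ i → f (p ↑ʳ i))
Σ-↑ zero    f = refl
Σ-↑ (suc p) f = trans (cong (_+_ (f zero)) (Σ-↑ p (f ∘ suc))) (sym (+-assoc (f zero) _ _))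

Σ-combine : ∀ p {q} (f : Fin (p * q) → ℕ) → Σᶠ f ≡ Σᶠ (λ i → Σᶠ λ j → f (combine {p} {q} i j))
Σ-combine zero        f = refl
Σ-combine (suc p) {q} f = trans (Σ-↑ q f) (cong (_+_ (Σᶠ (λ j → f (j ↑ˡ (p * q))))) (Σ-combine p (λ i → f (q ↑ʳ i))))

-- The lower bound

-- D(A) ≤ D with the subtraction moved across, so that no maximum has to be known to exist.
Bounded : ∀ {r t} → Matrix r t → ℕ → Set
Bounded A D = ∀ i j → 0 < A i j → columnSum A j ≤ D + A i j

module Rows {r t n : ℕ} (A : Matrix r t) (rows : ∀ i → rowSum A i ≡ n) where

  entry≤n : ∀ i j → A i j ≤ n
  entry≤n i j = subst (A i j ≤_) (rows i) (f≤Σ (A i) j)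

  entries≤n : ∀ i {j j′} → j ≢ j′ → A i j + A i j′ ≤ n
  entries≤n i j≢j′ = subst (_ ≤_) (rows i) (f+f≤Σ (A i) j≢j′)

  ΣcolumnSum : Σᶠ (columnSum A) ≡ r * n
  ΣcolumnSum = trans (sym (∑-comm A)) (trans (sum-cong-≗ rows) (Σ-const r))

  another-entry : ∀ i j → A i j < n → ∃ λ j′ → j ≢ j′ × 0 < A i j′
  another-entry i j Aij<n with any? (λ j′ → ¬? (j ≟ᶠ j′) ×-dec (0 <? A i j′))
  ... | yes p = p
  ... | no ¬p = contradiction (trans (sym (Σ-single j zeros)) (rows i)) (<⇒≢ Aij<n)
    where
    zeros : ∀ j′ → j′ ≢ j → A i j′ ≡ 0
    zeros j′ j′≢j = n≤0⇒n≡0 (≮⇒≥ λ p → ¬p (j′ , j′≢j ∘ sym , p))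

  module Columns {D : ℕ} (bounded : Bounded A D) where

    columnSum≤ : ∀ j → columnSum A j ≤ support (λ i → A i j) * n
    columnSum≤ j = Σ≤support* λ i → entry≤n i j

    support*excess≤ : ∀ j → support (λ i → A i j) * (columnSum A j ∸ D) ≤ columnSum A j
    support*excess≤ j = support*≤Σ λ i Aij>0 → m≤n+o⇒m∸n≤o (columnSum A j) D (bounded i j Aij>0)

    columnSum-pair≤ : ∀ i {j j′} → j ≢ j′ → 0 < A i j → 0 < A i j′ → columnSum A j + columnSum A j′ ≤ 2 * D + n
    columnSum-pair≤ i {j} {j′} j≢j′ p p′ = begin
      columnSum A j + columnSum A j′   ≤⟨ +-mono-≤ (bounded i j p) (bounded i j′ p′) ⟩
      (D + A i j) + (D + A i j′)       ≡⟨ eq D (A i j) (A i j′) ⟩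
      2 * D + (A i j + A i j′)         ≤⟨ +-monoʳ-≤ (2 * D) (entries≤n i j≢j′) ⟩
      2 * D + n                        ∎
      where
      open ≤-Reasoning
      eq : ∀ D x y → (D + x) + (D + y) ≡ 2 * D + (x + y)
      eq = solve-∀

module LowerBound (N β c : ℕ) {n : ℕ} (1≤n : 1 ≤ n)
  (A : Matrix (suc (Arithmetic.R N β c)) (Arithmetic.t N β c))
  (rows : ∀ i → rowSum A i ≡ n) where

  open Arithmetic N β c
  open Rows A rows

  SplitRow : Set
  SplitRow = ∃ λ i → ∃₂ λ j j′ → j ≢ j′ × 0 < A i j × 0 < A i j′

  splitRow? : SplitRow ⊎ (∀ i j → 0 < A i j → A i j ≡ n)
  splitRow? with any? (λ i → any? λ j → (0 <? A i j) ×-dec (A i j <? n))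
  ... | yes (i , j , p , q) = let j′ , j≢j′ , p′ = another-entry i j q in inj₁ (i , j , j′ , j≢j′ , p , p′)
  ... | no ¬p = inj₂ λ i j p → ≤-antisym (entry≤n i j) (≮⇒≥ λ q → ¬p (i , j , p , q))

  module _ {D : ℕ} (bounded : Bounded A D) where
    open Columns bounded

    excess : Fin t → ℕ
    excess j = columnSum A j ∸ D

    columnSum≤D+excess : ∀ j → columnSum A j ≤ D + excess j
    columnSum≤D+excess j = m≤n+m∸n (columnSum A j) D

    -- More than k positive entries, each at least the excess e, give (k + 1) e ≤ D + e; then e is
    -- cancelled.
    sparse-or-excess≤ : ∀ k j → columnSum A j ≤ k * n ⊎ k * excess j ≤ D
    sparse-or-excess≤ k j with support (λ i → A i j) ≤? k
    ... | yes p = inj₁ (≤-trans (columnSum≤ j) (*-monoˡ-≤ n p))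
    ... | no ¬p = inj₂ (+-cancelˡ-≤ (excess j) _ _ (begin
      suc k * excess j                        ≤⟨ *-monoˡ-≤ (excess j) (≰⇒> ¬p) ⟩
      support (λ i → A i j) * excess j        ≤⟨ support*excess≤ j ⟩
      columnSum A j                           ≤⟨ columnSum≤D+excess j ⟩
      D + excess j                            ≡⟨ +-comm D (excess j) ⟩
      excess j + D                            ∎))
      where open ≤-Reasoning

    -- The total exceeds t M n, so some column exceeds M n. It has at least M + 1 positive entries,
    -- all equal to n, and its sum is at most D + n.
    unsplit⇒Mn≤D : (∀ i j → 0 < A i j → A i j ≡ n) → M * n ≤ D
    unsplit⇒Mn≤D unsplit = +-cancelˡ-≤ n _ _ (begin
      suc M * n                     ≤⟨ *-monoˡ-≤ n M<support ⟩
      support (λ i → A i j) * n     ≤⟨ support*≤Σ (λ i p → ≤-reflexive (sym (unsplit i j p))) ⟩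
      columnSum A j                 ≤⟨ bounded i j Aij>0 ⟩
      D + A i j                     ≤⟨ +-monoʳ-≤ D (entry≤n i j) ⟩
      D + n                         ≡⟨ +-comm D n ⟩
      n + D                         ∎)
      where
      open ≤-Reasoning
      heavy : ∃ λ j → M * n < columnSum A j
      heavy = Σ>const⇒∃ (begin-strict
        t * (M * n)                    <⟨ m<m+n _ (<-≤-trans 1≤n (m≤m+n n (c * n))) ⟩
        t * (M * n) + (1 + c) * n      ≡⟨ eq M t c n ⟩
        suc R * n                      ≡⟨ ΣcolumnSum ⟨
        Σᶠ (columnSum A)               ∎)
        where
        eq : ∀ M t c n → t * (M * n) + (1 + c) * n ≡ (1 + (M * t + c)) * n
        eq = solve-∀
      j = proj₁ heavy
      M<support : M < support λ i → A i j
      M<support = ≰⇒> λ p → <⇒≱ (proj₂ heavy) (≤-trans (columnSum≤ j) (*-monoˡ-≤ n p))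
      positive : ∃ λ i → 0 < A i j
      positive = Σ>0⇒∃ (≤-<-trans z≤n (proj₂ heavy))
      i = proj₁ positive
      Aij>0 = proj₂ positive

    -- The weight `w` clears denominators: it is M when the bound for a column is (1 + 1/M) D, and 1
    -- when it is d + s.
    split-bound : SplitRow → ∀ w {C} → (∀ j → w * columnSum A j ≤ C) →
                  w * (suc R * n) ≤ w * (2 * D + n) + τ * C
    split-bound (i , j , j′ , j≢j′ , p , p′) w {C} bound = begin
      w * (suc R * n)
        ≡⟨ cong (w *_) (trans (sym ΣcolumnSum) (Σ-remove₂ (columnSum A) j≢j′)) ⟩
      w * (columnSum A j + (columnSum A j′ + Σᶠ rest))
        ≡⟨ eq w (columnSum A j) (columnSum A j′) (Σᶠ rest) ⟩
      w * (columnSum A j + columnSum A j′) + w * Σᶠ rest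
        ≤⟨ +-mono-≤ (*-monoʳ-≤ w (columnSum-pair≤ i j≢j′ p p′)) (begin
             w * Σᶠ rest               ≡⟨ *-distribˡ-sum w rest ⟩
             Σᶠ (λ l → w * rest l)     ≤⟨ Σ-≤-const (λ l → bound (others j≢j′ l)) ⟩
             τ * C                     ∎) ⟩
      w * (2 * D + n) + τ * C ∎
      where
      open ≤-Reasoning
      rest : Fin τ → ℕ
      rest l = columnSum A (others j≢j′ l)
      eq : ∀ w x y z → w * (x + (y + z)) ≡ w * (x + y) + w * z
      eq = solve-∀

    -- This is D ≥ d before rounding. If a row is split, M times a column sum is at most M (M n) for
    -- a column with at most M positive entries and at most (M + 1) D for any other. The larger of
    -- the two serves for all columns; it cannot be the first one strictly.
    MRn≤DK : M * R * n ≤ D * K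
    MRn≤DK with splitRow?
    ... | inj₂ unsplit = single-bound n D (unsplit⇒Mn≤D unsplit)
    ... | inj₁ split with suc M * D <? M * (M * n)
    ...   | no ¬p = double-bound n D (split-bound split M scaled)
      where
      scaled : ∀ j → M * columnSum A j ≤ suc M * D
      scaled j with sparse-or-excess≤ M j
      ... | inj₁ q = ≤-trans (*-monoʳ-≤ M q) (≮⇒≥ ¬p)
      ... | inj₂ q = begin
        M * columnSum A j       ≤⟨ *-monoʳ-≤ M (columnSum≤D+excess j) ⟩
        M * (D + excess j)      ≡⟨ *-distribˡ-+ M D (excess j) ⟩
        M * D + M * excess j    ≤⟨ +-monoʳ-≤ (M * D) q ⟩
        M * D + D               ≡⟨ +-comm (M * D) D ⟩
        suc M * D               ∎
        where open ≤-Reasoning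
    ...   | yes p = contradiction p (double-refutation n D (split-bound split M scaled))
      where
      scaled : ∀ j → M * columnSum A j ≤ M * (M * n)
      scaled j with sparse-or-excess≤ M j
      ... | inj₁ q = *-monoʳ-≤ M q
      ... | inj₂ q = begin
        M * columnSum A j       ≤⟨ *-monoʳ-≤ M (columnSum≤D+excess j) ⟩
        M * (D + excess j)      ≡⟨ *-distribˡ-+ M D (excess j) ⟩
        M * D + M * excess j    ≤⟨ +-monoʳ-≤ (M * D) q ⟩
        M * D + D               ≡⟨ +-comm (M * D) D ⟩
        suc M * D               ≤⟨ <⇒≤ p ⟩
        M * (M * n)             ∎
        where open ≤-Reasoning

  module _ {s T : ℕ} (T<M : T < M) (bounded : Bounded A (M * s + T)) where
    private
      d : ℕ
      d = M * s + T
    open Columns bounded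
    open Estimates n s T 1≤n T<M

    columnSum≤d+s : ∀ j → columnSum A j ≤ d + s
    columnSum≤d+s j with sparse-or-excess≤ bounded M j
    ... | inj₁ q = ≤-trans q (Mn≤d+s (MRn≤DK bounded))
    -- M times the excess is at most M s + T < M (s + 1), so the excess is at most s.
    ... | inj₂ q = ≤-trans (columnSum≤D+excess bounded j) (+-monoʳ-≤ d (s≤s⁻¹ (*-cancelˡ-< M _ _ (begin-strict
      M * excess bounded j   ≤⟨ q ⟩
      M * s + T              <⟨ +-monoʳ-< (M * s) T<M ⟩
      M * s + M              ≡⟨ trans (+-comm (M * s) M) (sym (*-suc M s)) ⟩
      M * suc s              ∎))))
      where open ≤-Reasoning

    rn≤ : SplitRow → suc R * n ≤ 2 * d + n + τ * (d + s)
    rn≤ split = subst₂ (λ x y → x ≤ y + τ * (d + s)) (*-identityˡ (suc R * n)) (*-identityˡ (2 * d + n))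
      (split-bound bounded split 1 (λ j → ≤-trans (≤-reflexive (*-identityˡ _)) (columnSum≤d+s j)))

    H≥0 : R * n ≤ t * d + τ * s
    H≥0 with splitRow?
    ... | inj₁ split = double⇒H≥0 (rn≤ split)
    ... | inj₂ unsplit = <⇒≤ (Mn≤d⇒H>0 (unsplit⇒Mn≤D bounded unsplit))

    module _ (H≡0 : t * d + τ * s ≡ R * n) where

      -- H = 0 turns the estimate `rn≤` into an equality, so for every split row each bound behind
      -- it is attained.
      total≡ : suc R * n ≡ 2 * d + n + τ * (d + s)
      total≡ = trans (cong (_+_ n) (sym H≡0)) (eq n τ d s)
        where
        eq : ∀ n τ d s → n + ((2 + τ) * d + τ * s) ≡ 2 * d + n + τ * (d + s)
        eq = solve-∀

      split⇒tight : ∀ i {j j′} → j ≢ j′ → 0 < A i j → 0 < A i j′ →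
                    2 * d + n ≤ columnSum A j + columnSum A j′
      split⇒tight i {j} {j′} j≢j′ p p′ = +-cancelʳ-≤ (τ * (d + s)) _ _ (begin
        2 * d + n + τ * (d + s)                               ≡⟨ total≡ ⟨
        suc R * n                                             ≡⟨ trans (sym ΣcolumnSum) (Σ-remove₂ (columnSum A) j≢j′) ⟩
        columnSum A j + (columnSum A j′ + Σᶠ rest)            ≡⟨ +-assoc (columnSum A j) (columnSum A j′) (Σᶠ rest) ⟨
        columnSum A j + columnSum A j′ + Σᶠ rest              ≤⟨ +-monoʳ-≤ (columnSum A j + columnSum A j′) (Σ-≤-const (λ l → columnSum≤d+s (others j≢j′ l))) ⟩
        columnSum A j + columnSum A j′ + τ * (d + s)          ∎)
        where
        open ≤-Reasoning
        rest : Fin τ → ℕ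
        rest l = columnSum A (others j≢j′ l)

      -- As t ≥ 3, τ is a successor and a third column exists. The pair takes at most 2 d + n and
      -- the `pred τ` columns left over at most d + s each.
      split⇒d+s≤other : ∀ i {j j′} (j≢j′ : j ≢ j′) → 0 < A i j → 0 < A i j′ →
                        d + s ≤ columnSum A (others j≢j′ zero)
      split⇒d+s≤other i {j} {j′} j≢j′ p p′ = +-cancelˡ-≤ (2 * d + n) _ _ (+-cancelʳ-≤ (pred τ * (d + s)) _ _ (begin
        2 * d + n + (d + s) + pred τ * (d + s)                         ≡⟨ +-assoc (2 * d + n) _ _ ⟩
        2 * d + n + τ * (d + s)                                        ≡⟨ total≡ ⟨
        suc R * n                                                      ≡⟨ trans (sym ΣcolumnSum) (Σ-remove₂ (columnSum A) j≢j′) ⟩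
        columnSum A j + (columnSum A j′ + (rest zero + Σᶠ (rest ∘ suc)))  ≡⟨ eq (columnSum A j) (columnSum A j′) (rest zero) (Σᶠ (rest ∘ suc)) ⟩
        columnSum A j + columnSum A j′ + rest zero + Σᶠ (rest ∘ suc)
          ≤⟨ +-mono-≤ (+-monoˡ-≤ (rest zero) (columnSum-pair≤ i j≢j′ p p′)) (Σ-≤-const (λ l → columnSum≤d+s (others j≢j′ (suc l)))) ⟩
        2 * d + n + rest zero + pred τ * (d + s)                       ∎))
        where
        open ≤-Reasoning
        rest : Fin τ → ℕ
        rest l = columnSum A (others j≢j′ l)
        eq : ∀ x y z w → x + (y + (z + w)) ≡ x + y + z + w
        eq = solve-∀

      -- An entry x below n shares its row with some y > 0 in a column of sum at most d + y. The two
      -- columns have total at least 2 d + n ≥ 2 d + x + y by tightness, so x ≤ s; boundedness of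
      -- column l gives x ≥ s.
      saturated-entry : ∀ {l} → columnSum A l ≡ d + s → ∀ i → 0 < A i l → A i l ≡ s ⊎ A i l ≡ n
      saturated-entry {l} saturated i p with A i l <? n
      ... | no ¬q = inj₂ (≤-antisym (entry≤n i l) (≮⇒≥ ¬q))
      ... | yes q = let j , l≢j , p′ = another-entry i l q in
        inj₁ (≤-antisym (+-cancelˡ-≤ d _ _ (+-cancelʳ-≤ (d + A i j) _ _ (begin
          d + A i l + (d + A i j)            ≡⟨ eq d (A i l) (A i j) ⟩
          2 * d + (A i l + A i j)            ≤⟨ +-monoʳ-≤ (2 * d) (entries≤n i l≢j) ⟩
          2 * d + n                          ≤⟨ split⇒tight i l≢j p p′ ⟩
          columnSum A l + columnSum A j      ≤⟨ +-mono-≤ (≤-reflexive saturated) (bounded i j p′) ⟩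
          d + s + (d + A i j)                ∎)))
          (+-cancelˡ-≤ d _ _ (subst (_≤ d + A i l) saturated (bounded i l p))))
        where
        open ≤-Reasoning
        eq : ∀ d x y → d + x + (d + y) ≡ 2 * d + (x + y)
        eq = solve-∀

      -- Compare d + s = (M + 1) s + T with the number of positive entries. At most M are too few,
      -- since M n < d + s; at least M + 2 of them force n - s = 1; and M + 1 of them, p being n and
      -- the others s, leave T = p (n - s).
      saturated⇒n∸s∣T : s < n → ∀ {l} → columnSum A l ≡ d + s → (n ∸ s) ∣ T
      saturated⇒n∸s∣T s<n {l} saturated with <-cmp (support (λ i → A i l)) (suc M)
      ... | tri< (s≤s k≤M) _ _ = contradiction
              (Mn<d+s (MRn≤DK bounded) H≡0)
              (≤⇒≯ (≤-trans (≤-reflexive (sym saturated)) (≤-trans (columnSum≤ l) (*-monoˡ-≤ n k≤M))))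
      ... | tri> _ _ k≥M+2 = divides T (sym (trans (cong (T *_) n∸s≡1) (*-identityʳ T)))
        where
        open ≤-Reasoning
        n≤s+1 : n ≤ suc s
        n≤s+1 = overfull⇒n≤s+1 (MRn≤DK bounded) H≡0 (begin
          (2 + M) * s                                     ≤⟨ *-monoˡ-≤ s k≥M+2 ⟩
          support (λ i → A i l) * s                       ≡⟨ cong (support (λ i → A i l) *_) (m+n∸m≡n d s) ⟨
          support (λ i → A i l) * (d + s ∸ d)             ≡⟨ cong (λ x → support (λ i → A i l) * (x ∸ d)) saturated ⟨
          support (λ i → A i l) * (columnSum A l ∸ d)     ≤⟨ support*excess≤ l ⟩
          columnSum A l                                   ≡⟨ saturated ⟩
          d + s                                           ∎)
        n∸s≡1 : n ∸ s ≡ 1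
        n∸s≡1 = trans (cong (_∸ s) (≤-antisym n≤s+1 s<n)) (m+n∸n≡m 1 s)
      ... | tri≈ _ k≡M+1 _ = divides p (+-cancelˡ-≡ (suc M * s) _ _ (begin-equality
          suc M * s + T                                    ≡⟨ eq M s T ⟩
          d + s                                            ≡⟨ saturated ⟨
          columnSum A l                                    ≡⟨ columnSum≡ ⟩
          support (λ i → A i l) * s + p * (n ∸ s)          ≡⟨ cong (λ k → k * s + p * (n ∸ s)) k≡M+1 ⟩
          suc M * s + p * (n ∸ s)                          ∎))
        where
        open ≤-Reasoning
        eq : ∀ M s T → (1 + M) * s + T ≡ M * s + T + s
        eq = solve-∀
        two-valued = Σ-two-valued {f = λ i → A i l} s (n ∸ s) λ i q →
          map₂ (λ x≡n → trans x≡n (sym (m+[n∸m]≡n (<⇒≤ s<n)))) (saturated-entry saturated i q)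
        p = proj₁ two-valued
        columnSum≡ = proj₂ two-valued

      n∸s∣T : s < n → (n ∸ s) ∣ T
      n∸s∣T s<n with splitRow?
      ... | inj₁ (i , j , j′ , j≢j′ , p , p′) = saturated⇒n∸s∣T s<n
              (≤-antisym (columnSum≤d+s (others j≢j′ zero)) (split⇒d+s≤other i j≢j′ p p′))
      -- Without a split row M n ≤ d, which makes H positive.
      ... | inj₂ unsplit = contradiction (sym H≡0) (<⇒≢ (Mn≤d⇒H>0 (unsplit⇒Mn≤D bounded unsplit)))

-- The construction

-- The m entries of a leaf column, the first `g` raised by `h`; with g h = T they sum to m s + T = d
-- + s.
staircase : (s h g : ℕ) → Fin k → ℕ
staircase s h g x = s + (if toℕ x <ᵇ g then h else 0)

Σ-staircase : ∀ k {s h g} → g ≤ k → Σᶠ {k} (staircase s h g) ≡ k * s + g * h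
Σ-staircase zero    z≤n = refl
Σ-staircase (suc k) {s} {h} z≤n = trans (cong₂ _+_ (+-identityʳ s) (Σ-staircase k {s} {h} z≤n)) (sym (+-assoc s _ _))
Σ-staircase (suc k) {s} {h} {suc g} (s≤s g≤k) = trans (cong (_+_ (s + h)) (Σ-staircase k g≤k)) (eq s h k g)
  where
  eq : ∀ s h k g → s + h + (k * s + g * h) ≡ (1 + k) * s + (1 + g) * h
  eq = solve-∀

-- Column zero is the centre; p rows lie in it entirely, and row (l , x) of the
-- others splits into v x in leaf column suc l and n ∸ v x in the centre.
module Star (p q μ n : ℕ) (v : Fin μ → ℕ) (v≤n : ∀ x → v x ≤ n) where

  leafRow : Fin q × Fin μ → Fin (suc q) → ℕ
  leafRow (l , x) zero    = n ∸ v x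
  leafRow (l , x) (suc j) = if does (j ≟ᶠ l) then v x else 0

  row : Fin p ⊎ Fin (q * μ) → Fin (suc q) → ℕ
  row (inj₁ _) zero    = n
  row (inj₁ _) (suc _) = 0
  row (inj₂ y) j       = leafRow (remQuot {q} μ y) j

  star : Matrix (p + q * μ) (suc q)
  star i = row (splitAt p i)

  leafRow-sum : ∀ l x → Σᶠ (leafRow (l , x)) ≡ n
  leafRow-sum l x = trans (cong (_+_ (n ∸ v x)) (trans (Σ-single l off) on)) (m∸n+n≡m (v≤n x))
    where
    off : ∀ j → j ≢ l → leafRow (l , x) (suc j) ≡ 0
    off j j≢l with j ≟ᶠ l
    ... | yes j≡l = contradiction j≡l j≢l
    ... | no _ = refl
    on : leafRow (l , x) (suc l) ≡ v x
    on with l ≟ᶠ l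
    ... | yes _ = refl
    ... | no l≢l = contradiction refl l≢l

  star-rows : ∀ i → rowSum star i ≡ n
  star-rows i with splitAt p i
  ... | inj₁ _ = trans (cong (_+_ n) (trans (Σ-const q) (*-zeroʳ q))) (+-identityʳ n)
  ... | inj₂ y = uncurry leafRow-sum (remQuot {q} μ y)

  leaf-columnSum : ∀ j → columnSum star (suc j) ≡ Σᶠ v
  leaf-columnSum j = begin
    columnSum star (suc j)
      ≡⟨ Σ-↑ p (λ i → star i (suc j)) ⟩
    Σᶠ (λ i → row (splitAt p (i ↑ˡ (q * μ))) (suc j)) + Σᶠ (λ i → row (splitAt p (p ↑ʳ i)) (suc j))
      ≡⟨ cong₂ _+_ (sum-cong-≗ λ i → cong (λ y → row y (suc j)) (splitAt-↑ˡ p i (q * μ)))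
                   (sum-cong-≗ λ i → cong (λ y → row y (suc j)) (splitAt-↑ʳ p (q * μ) i)) ⟩
    Σᶠ {p} (λ _ → 0) + Σᶠ (λ i → leafRow (remQuot {q} μ i) (suc j))
      ≡⟨ cong₂ _+_ (trans (Σ-const p) (*-zeroʳ p)) (Σ-combine q {μ} (λ i → leafRow (remQuot {q} μ i) (suc j))) ⟩
    Σᶠ (λ l → Σᶠ λ x → leafRow (remQuot {q} μ (combine {q} {μ} l x)) (suc j))
      ≡⟨ (sum-cong-≗ λ l → sum-cong-≗ λ x → cong (λ y → leafRow y (suc j)) (remQuot-combine {q} {μ} l x)) ⟩
    Σᶠ (λ l → Σᶠ λ x → leafRow (l , x) (suc j))
      ≡⟨ ∑-comm (λ l x → leafRow (l , x) (suc j)) ⟩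
    Σᶠ (λ x → Σᶠ λ l → leafRow (l , x) (suc j))
      ≡⟨ (sum-cong-≗ λ x → trans (Σ-single j (off x)) (on x)) ⟩
    Σᶠ v ∎
    where
    open ≡-Reasoning
    off : ∀ x l → l ≢ j → leafRow (l , x) (suc j) ≡ 0
    off x l l≢j with j ≟ᶠ l
    ... | yes j≡l = contradiction (sym j≡l) l≢j
    ... | no _ = refl
    on : ∀ x → leafRow (j , x) (suc j) ≡ v x
    on x with j ≟ᶠ j
    ... | yes _ = refl
    ... | no j≢j = contradiction refl j≢j

  -- The centre is found from the total of all columns, without summing its entries.
  centre-columnSum : columnSum star zero + q * Σᶠ v ≡ (p + q * μ) * n
  centre-columnSum = trans
    (cong (_+_ (columnSum star zero)) (trans (sym (Σ-const q)) (sum-cong-≗ {q} λ j → sym (leaf-columnSum j))))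
    (Rows.ΣcolumnSum star star-rows)

  star-bounded : ∀ {D} → columnSum star zero ≤ D + n →
                 (∀ x → 0 < n ∸ v x → columnSum star zero ≤ D + (n ∸ v x)) →
                 (∀ x → Σᶠ v ≤ D + v x) → Bounded star D
  star-bounded {D} full centre leaf i j = bound (splitAt p i) j
    where
    leaf-bound : ∀ l x j → 0 < leafRow (l , x) (suc j) → columnSum star (suc j) ≤ D + leafRow (l , x) (suc j)
    leaf-bound l x j q with j ≟ᶠ l
    ... | yes _ = ≤-trans (≤-reflexive (leaf-columnSum j)) (leaf x)

    bound : ∀ y j → 0 < row y j → columnSum star j ≤ D + row y j
    bound (inj₁ _) zero    _ = full
    bound (inj₂ y) zero    = centre (proj₂ (remQuot {q} μ y))
    bound (inj₂ y) (suc j) = uncurry leaf-bound (remQuot {q} μ y) j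

-- N = β + p encodes a ≤ m: `p` is m - a, the number of rows lying in the centre entirely.
module UpperBound (β c p : ℕ) where

  open Arithmetic (β + p) β c

  module _ {n s T h g : ℕ} (gh≡T : g * h ≡ T) (g≤m : g ≤ suc M) (s+h≤n : s + h ≤ n) where
    private
      d H₊ H₋ : ℕ
      d = M * s + T
      H₊ = t * d + τ * s
      H₋ = R * n
      v : Fin (suc M) → ℕ
      v = staircase s h g

      v-cases : ∀ x → v x ≡ s + h ⊎ v x ≡ s
      v-cases x with toℕ x <ᵇ g
      ... | true  = inj₁ refl
      ... | false = inj₂ (+-identityʳ s)

      v≤n : ∀ x → v x ≤ n
      v≤n x with v-cases x
      ... | inj₁ eq = subst (_≤ n) (sym eq) s+h≤n
      ... | inj₂ eq = subst (_≤ n) (sym eq) (m+n≤o⇒m≤o s s+h≤n)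

      Σv≡d+s : Σᶠ v ≡ d + s
      Σv≡d+s = trans (Σ-staircase (suc M) {s} g≤m) (trans (cong (_+_ (suc M * s)) gh≡T) (eq M s T))
        where
        eq : ∀ M s T → (1 + M) * s + T ≡ M * s + T + s
        eq = solve-∀

      open Star p (suc τ) (suc M) n v v≤n

      c₀ : ℕ
      c₀ = columnSum star zero

      -- The centre has sum r n - (t - 1) (d + s), so its bound at an entry n - (s + h) says exactly
      -- h ≤ H.
      c₀-slack : ∀ h → h + H₋ ≤ H₊ → c₀ ≤ d + (n ∸ (s + h)) ⊎ n < s + h
      c₀-slack h slack with s + h ≤? n
      ... | no ¬p = inj₂ (≰⇒> ¬p)
      ... | yes s+h≤n = inj₁ (+-cancelʳ-≤ (s + h) _ _ (begin
        c₀ + (s + h)              ≤⟨ ≤-certificate 0 (+-mono-≤ slack (≤-reflexive total)) (eq β p c n s T h c₀) ⟩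
        d + n                     ≡⟨ cong (_+_ d) (m∸n+n≡m s+h≤n) ⟨
        d + (n ∸ (s + h) + (s + h)) ≡⟨ +-assoc d _ _ ⟨
        d + (n ∸ (s + h)) + (s + h) ∎))
        where
        open ≤-Reasoning
        total : c₀ + suc τ * (d + s) ≡ (p + suc τ * suc M) * n
        total = trans (cong (λ x → c₀ + suc τ * x) (sym Σv≡d+s)) centre-columnSum
        eq : ∀ β p c n s T h c₀ → let M = 1 + (β + p); τ = 1 + (β + c); t = 2 + τ; R = M * t + c; d = M * s + T in
          t * d + τ * s + (p + (1 + τ) * (1 + M)) * n + (c₀ + (s + h) + 0)
          ≡ h + R * n + (c₀ + (1 + τ) * (d + s)) + (d + n)
        eq = solve-∀

    -- In the centre, rows that are not raised need 0 ≤ H. Raised ones need h ≤ H, unless s + h = n: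
    -- then their centre entry is 0 and imposes nothing.
    bounded-matrix : H₋ ≤ H₊ → h + H₋ ≤ H₊ ⊎ s + h ≡ n →
                     ∃ λ (A : Matrix (suc R) t) → (∀ i → rowSum A i ≡ n) × Bounded A d
    bounded-matrix H≥0 slack = subst (λ r → ∃ λ (A : Matrix r t) → (∀ i → rowSum A i ≡ n) × Bounded A d)
      (eq β p c) (star , star-rows , star-bounded full centre leaf)
      where
      eq : ∀ β p c → let M = 1 + (β + p); τ = 1 + (β + c); t = 2 + τ; R = M * t + c in
        p + (1 + τ) * (1 + M) ≡ 1 + R
      eq = solve-∀
      s≤n : s ≤ n
      s≤n = m+n≤o⇒m≤o s s+h≤n
      c₀≤ : c₀ ≤ d + (n ∸ s)
      c₀≤ with c₀-slack 0 H≥0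
      ... | inj₁ q = subst (λ x → c₀ ≤ d + (n ∸ x)) (+-identityʳ s) q
      ... | inj₂ q = contradiction (subst (_≤ n) (sym (+-identityʳ s)) s≤n) (<⇒≱ q)
      full : c₀ ≤ d + n
      full = ≤-trans c₀≤ (+-monoʳ-≤ d (m∸n≤m n s))
      raised : h + H₋ ≤ H₊ ⊎ s + h ≡ n → 0 < n ∸ (s + h) → c₀ ≤ d + (n ∸ (s + h))
      raised (inj₂ s+h≡n) q = contradiction (trans (cong (n ∸_) s+h≡n) (n∸n≡0 n)) (>⇒≢ q)
      raised (inj₁ h+H₋≤H₊) q with c₀-slack h h+H₋≤H₊
      ... | inj₁ r = r
      ... | inj₂ r = contradiction s+h≤n (<⇒≱ r)
      centre : ∀ x → 0 < n ∸ v x → c₀ ≤ d + (n ∸ v x)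
      centre x q with v-cases x
      ... | inj₂ eq rewrite eq = c₀≤
      ... | inj₁ eq rewrite eq = raised slack q
      leaf : ∀ x → Σᶠ v ≤ d + v x
      leaf x = ≤-trans (≤-reflexive Σv≡d+s) (+-monoʳ-≤ d (m≤m+n s _))

-- Matrices and graphs

maximum-exists : ∀ {ℓ} {P : Pred ℕ ℓ} → Decidable P → ∀ N → (∀ {j} → P j → j ≤ N) → ∃ P → ∃ (IsMaximum P)
maximum-exists P? N bound (j , Pj) with P? N
... | yes PN = N , PN , bound
maximum-exists {P = P} P? zero bound (j , Pj) | no ¬P0 = contradiction (subst P (n≤0⇒n≡0 (bound Pj)) Pj) ¬P0
maximum-exists {P = P} P? (suc N) bound (j , Pj) | no ¬PN =
  maximum-exists P? N (λ Pi → s≤s⁻¹ (≤∧≢⇒< (bound Pi) λ { refl → ¬PN Pi })) (j , Pj)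

minimum-exists : ∀ {ℓ} {P : Pred ℕ ℓ} → Decidable P → ∀ N → P N → ∃ λ k → IsMinimum P k × k ≤ N
minimum-exists P? N PN with P? 0
... | yes P0 = 0 , (P0 , λ _ → z≤n) , z≤n
minimum-exists P? zero    PN | no ¬P0 = contradiction PN ¬P0
minimum-exists {P = P} P? (suc N) PN | no ¬P0 =
  let k , (Pk , least) , k≤N = minimum-exists (P? ∘ suc) N PN in
  suc k , (Pk , λ { {zero} P0 → contradiction P0 ¬P0 ; {suc j} Pj → s≤s (least Pj) }) , s≤s k≤N

module _ {r t : ℕ} (A : Matrix r t) where

  IsD⇒Bounded : ∀ {k} → IsD A k → Bounded A k
  IsD⇒Bounded {k} (_ , max) i j p = subst (columnSum A j ≤_) (+-comm (A i j) k)
    (≤-trans (m≤n+m∸n (columnSum A j) (A i j)) (+-monoʳ-≤ (A i j) (max (i , j , p , refl))))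

  Bounded⇒IsD≤ : ∀ {k D} → Bounded A D → IsD A k → k ≤ D
  Bounded⇒IsD≤ {D = D} bounded ((i , j , p , refl) , _) =
    m≤n+o⇒m∸n≤o (columnSum A j) (A i j) (subst (columnSum A j ≤_) (+-comm D (A i j)) (bounded i j p))

  D-exists : ∀ {n} → 1 ≤ r → 1 ≤ n → (∀ i → rowSum A i ≡ n) → ∃ (IsD A)
  D-exists {n} (s≤s _) 1≤n rows = maximum-exists dec (r * n) bound attained
    where
    dec : ∀ k → Dec (∃₂ λ i j → 0 < A i j × columnSum A j ∸ A i j ≡ k)
    dec k = any? λ i → any? λ j → (0 <? A i j) ×-dec (columnSum A j ∸ A i j ≟ k)
    bound : ∀ {k} → (∃₂ λ i j → 0 < A i j × columnSum A j ∸ A i j ≡ k) → k ≤ r * n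
    bound (i , j , _ , refl) = ≤-trans (m∸n≤m _ (A i j)) (Σ-≤-const λ i′ → Rows.entry≤n A rows i′ j)
    attained : ∃ λ k → ∃₂ λ i j → 0 < A i j × columnSum A j ∸ A i j ≡ k
    attained = let j , p = Σ>0⇒∃ (subst (0 <_) (sym (rows zero)) 1≤n) in _ , zero , j , p , refl

-- The minimum of D(A), phrased by `Bounded`: a matrix with D(A) ≤ D suffices, equality then
-- following from `least`.
record Optimal (n r t D : ℕ) : Set where
  field
    attained : Σ[ A ∈ Matrix r t ] (∀ i → rowSum A i ≡ n) × Bounded A D
    least    : ∀ (A : Matrix r t) → (∀ i → rowSum A i ≡ n) → ∀ {D′} → Bounded A D′ → D ≤ D′

module _ {n r t D : ℕ} (1≤r : 1 ≤ r) (1≤n : 1 ≤ n) (optimal : Optimal n r t D) where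
  open Optimal optimal

  optimal-matrix : Σ[ A ∈ Matrix r t ] (∀ i → rowSum A i ≡ n) × IsD A D
  optimal-matrix with attained
  ... | A , rows , bounded with D-exists A 1≤r 1≤n rows
  ...   | k , isD with ≤-antisym (Bounded⇒IsD≤ A bounded isD) (least A rows (IsD⇒Bounded A isD))
  ...     | refl = A , rows , isD

  optimal⇒IsMinD : IsMinD n r t D
  optimal⇒IsMinD = optimal-matrix , λ (A , rows , isD) → least A rows (IsD⇒Bounded A isD)

-- Counting vertices by part and colour

⟦_⟧ : ∀ {ℓ} {P : Set ℓ} → Dec P → ℕ
⟦ P? ⟧ = if does P? then 1 else 0

count-tabulate : ∀ {a ℓ} {A : Set a} {P : Pred A ℓ} (P? : Decidable P) (f : Fin k → A) →
                 count P? (tabulate f) ≡ Σᶠ λ i → ⟦ P? (f i) ⟧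
count-tabulate {k = zero}  P? f = refl
count-tabulate {k = suc k} P? f with does (P? (f zero))
... | true  = cong suc (count-tabulate P? (f ∘ suc))
... | false = count-tabulate P? (f ∘ suc)

Σ-⟦≟⟧ : (x : Fin k) (f : Fin k → ℕ) → Σᶠ (λ i → ⟦ x ≟ᶠ i ⟧ * f i) ≡ f x
Σ-⟦≟⟧ x f = trans (Σ-single x off) on
  where
  off : ∀ i → i ≢ x → ⟦ x ≟ᶠ i ⟧ * f i ≡ 0
  off i i≢x with x ≟ᶠ i
  ... | yes x≡i = contradiction (sym x≡i) i≢x
  ... | no _ = refl
  on : ⟦ x ≟ᶠ x ⟧ * f x ≡ f x
  on with x ≟ᶠ x
  ... | yes _ = +-identityʳ (f x)
  ... | no x≢x = contradiction refl x≢x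

⟦⟧-inclusion–exclusion : ∀ {a b} {P : Set a} {Q : Set b} (P? : Dec P) (Q? : Dec Q) →
                         ⟦ ¬? P? ×-dec ¬? Q? ⟧ + ⟦ P? ⟧ + ⟦ Q? ⟧ ≡ 1 + ⟦ P? ⟧ * ⟦ Q? ⟧
⟦⟧-inclusion–exclusion (yes _) (yes _) = refl
⟦⟧-inclusion–exclusion (yes _) (no _)  = refl
⟦⟧-inclusion–exclusion (no _)  (yes _) = refl
⟦⟧-inclusion–exclusion (no _)  (no _)  = refl

⟦⟧-mono : ∀ {a b} {P : Set a} {Q : Set b} (P? : Dec P) (Q? : Dec Q) → (P → Q) → ⟦ P? ⟧ ≤ ⟦ Q? ⟧
⟦⟧-mono (no _)  _       _   = z≤n
⟦⟧-mono (yes _) (yes _) _   = ≤-refl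
⟦⟧-mono (yes p) (no ¬q) p→q = contradiction (p→q p) ¬q

module Labelling {N r t : ℕ} (part : Fin N → Fin r) (colour : Fin N → Fin t) where

  incidence : Matrix r t
  incidence i j = Σᶠ λ v → ⟦ part v ≟ᶠ i ⟧ * ⟦ colour v ≟ᶠ j ⟧

  incidence-columnSum : ∀ j → columnSum incidence j ≡ Σᶠ λ v → ⟦ colour v ≟ᶠ j ⟧
  incidence-columnSum j = trans (∑-comm (λ i v → ⟦ part v ≟ᶠ i ⟧ * ⟦ colour v ≟ᶠ j ⟧))
    (sum-cong-≗ λ v → Σ-⟦≟⟧ (part v) λ _ → ⟦ colour v ≟ᶠ j ⟧)

  incidence-rowSum : ∀ i → rowSum incidence i ≡ Σᶠ λ v → ⟦ part v ≟ᶠ i ⟧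
  incidence-rowSum i = trans (∑-comm (λ j v → ⟦ part v ≟ᶠ i ⟧ * ⟦ colour v ≟ᶠ j ⟧))
    (sum-cong-≗ λ v → trans (sum-cong-≗ λ j → *-comm ⟦ part v ≟ᶠ i ⟧ ⟦ colour v ≟ᶠ j ⟧)
      (Σ-⟦≟⟧ (colour v) λ _ → ⟦ part v ≟ᶠ i ⟧))

  incidence-self : ∀ v → 0 < incidence (part v) (colour v)
  incidence-self v = <-≤-trans self (f≤Σ _ v)
    where
    self : 0 < ⟦ part v ≟ᶠ part v ⟧ * ⟦ colour v ≟ᶠ colour v ⟧
    self with part v ≟ᶠ part v | colour v ≟ᶠ colour v
    ... | yes _ | yes _ = z<s
    ... | no ¬p | _     = contradiction refl ¬p
    ... | yes _ | no ¬p = contradiction refl ¬p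

  incidence>0⇒∃ : ∀ {i j} → 0 < incidence i j → ∃ λ v → part v ≡ i × colour v ≡ j
  incidence>0⇒∃ {i} {j} p = let v , q = Σ>0⇒∃ p in v , labels v q
    where
    labels : ∀ v → 0 < ⟦ part v ≟ᶠ i ⟧ * ⟦ colour v ≟ᶠ j ⟧ → part v ≡ i × colour v ≡ j
    labels v q with part v ≟ᶠ i | colour v ≟ᶠ j
    ... | yes p₁ | yes p₂ = p₁ , p₂

  -- The number of possible neighbours of a vertex of part `i` and colour `j`, since a neighbour
  -- must differ in both.
  farDegree : Fin r → Fin t → ℕ
  farDegree i j = Σᶠ λ w → ⟦ ¬? (part w ≟ᶠ i) ×-dec ¬? (colour w ≟ᶠ j) ⟧

  module _ {n : ℕ} (size : ∀ i → Σᶠ (λ v → ⟦ part v ≟ᶠ i ⟧) ≡ n) where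

    order≡ : N ≡ r * n
    order≡ = begin
      N                                                 ≡⟨ *-identityʳ N ⟨
      N * 1                                             ≡⟨ Σ-const N ⟨
      Σᶠ {N} (λ _ → 1)                                  ≡⟨ (sum-cong-≗ λ v → Σ-⟦≟⟧ (part v) (λ _ → 1)) ⟨
      Σᶠ (λ v → Σᶠ λ i → ⟦ part v ≟ᶠ i ⟧ * 1)           ≡⟨ ∑-comm (λ v i → ⟦ part v ≟ᶠ i ⟧ * 1) ⟩
      Σᶠ (λ i → Σᶠ λ v → ⟦ part v ≟ᶠ i ⟧ * 1)           ≡⟨ (sum-cong-≗ λ i → trans (sum-cong-≗ λ v → *-identityʳ ⟦ part v ≟ᶠ i ⟧) (size i)) ⟩
      Σᶠ {r} (λ _ → n)                                  ≡⟨ Σ-const r ⟩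
      r * n                                             ∎
      where open ≡-Reasoning

    -- Inclusion-exclusion summed over the r n vertices: n lie in part i, the column sum counts
    -- colour j, and the entry counts both.
    farDegree+columnSum : ∀ i j → farDegree i j + n + columnSum incidence j ≡ r * n + incidence i j
    farDegree+columnSum i j = begin
      farDegree i j + n + columnSum incidence j
        ≡⟨ cong₂ (λ x y → farDegree i j + x + y) (sym (size i)) (incidence-columnSum j) ⟩
      farDegree i j + Σᶠ (λ w → ⟦ part w ≟ᶠ i ⟧) + Σᶠ (λ w → ⟦ colour w ≟ᶠ j ⟧)
        ≡⟨ cong (_+ Σᶠ (λ w → ⟦ colour w ≟ᶠ j ⟧)) (∑-distrib-+ _ (λ w → ⟦ part w ≟ᶠ i ⟧)) ⟨
      Σᶠ (λ w → ⟦ ¬? (part w ≟ᶠ i) ×-dec ¬? (colour w ≟ᶠ j) ⟧ + ⟦ part w ≟ᶠ i ⟧) + Σᶠ (λ w → ⟦ colour w ≟ᶠ j ⟧)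
        ≡⟨ ∑-distrib-+ _ (λ w → ⟦ colour w ≟ᶠ j ⟧) ⟨
      Σᶠ (λ w → ⟦ ¬? (part w ≟ᶠ i) ×-dec ¬? (colour w ≟ᶠ j) ⟧ + ⟦ part w ≟ᶠ i ⟧ + ⟦ colour w ≟ᶠ j ⟧)
        ≡⟨ (sum-cong-≗ λ w → ⟦⟧-inclusion–exclusion (part w ≟ᶠ i) (colour w ≟ᶠ j)) ⟩
      Σᶠ (λ w → 1 + ⟦ part w ≟ᶠ i ⟧ * ⟦ colour w ≟ᶠ j ⟧)
        ≡⟨ ∑-distrib-+ (λ _ → 1) (λ w → ⟦ part w ≟ᶠ i ⟧ * ⟦ colour w ≟ᶠ j ⟧) ⟩
      Σᶠ {N} (λ _ → 1) + incidence i j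
        ≡⟨ cong (_+ incidence i j) (trans (Σ-const N) (trans (*-identityʳ N) order≡)) ⟩
      r * n + incidence i j ∎
      where open ≡-Reasoning

-- Coding colourings by `Fin (k ^ N)` makes the search finite; the chromatic number is then found as
-- a least element.
colourable? : ∀ {N} (G : SimpleGraph N) → Decidable (SimpleGraph.Colourable G)
colourable? {N} G k = map′ (λ (c , proper) → finToFun c , λ {u} {v} → proper u v) encode
  (any? {n = k ^ N} λ c → all? λ u → all? λ v → (u ~? v) →-dec ¬? (finToFun c u ≟ᶠ finToFun c v))
  where
  open SimpleGraph G using (Colourable; _~_; _~?_)
  encode : Colourable k → ∃ λ c → ∀ u v → u ~ v → finToFun {k} {N} c u ≢ finToFun c v
  encode (c , proper) = funToFin c , λ u v u~v eq →
    proper u~v (trans (sym (finToFun-funToFin c u)) (trans eq (finToFun-funToFin c v)))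

-- A finite family of labels specified by the functional that sums over it; disjoint union of
-- families is addition of functionals.
record Realisation {X : Set} (F : (X → ℕ) → ℕ) : Set where
  field
    size    : ℕ
    label   : Fin size → X
    Σ-label : ∀ g → Σᶠ (g ∘ label) ≡ F g
open Realisation

copies : ∀ {X} a (x : X) → Realisation (λ g → a * g x)
copies a x = record { size = a ; label = λ _ → x ; Σ-label = λ _ → Σ-const a }

_⊕_ : ∀ {X} {F G : (X → ℕ) → ℕ} → Realisation F → Realisation G → Realisation (λ g → F g + G g)
ρ ⊕ σ = record
  { size    = size ρ + size σ
  ; label   = [ label ρ , label σ ]′ ∘ splitAt (size ρ)
  ; Σ-label = λ g → trans (Σ-↑ (size ρ) _) (cong₂ _+_
      (trans (sum-cong-≗ λ i → cong (g ∘ [ label ρ , label σ ]′) (splitAt-↑ˡ (size ρ) i (size σ))) (Σ-label ρ g))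
      (trans (sum-cong-≗ λ i → cong (g ∘ [ label ρ , label σ ]′) (splitAt-↑ʳ (size ρ) (size σ) i)) (Σ-label σ g)))
  }

⨁ : ∀ {X} {F : Fin k → (X → ℕ) → ℕ} → (∀ i → Realisation (F i)) → Realisation (λ g → Σᶠ λ i → F i g)
⨁ {k = zero}  ρ = record { size = 0 ; label = λ () ; Σ-label = λ _ → refl }
⨁ {k = suc k} ρ = ρ zero ⊕ ⨁ (ρ ∘ suc)

-- A vertex set with A i j vertices of part i and colour j.
realise : ∀ {r t} (A : Matrix r t) → Realisation (λ g → Σᶠ λ i → Σᶠ λ j → A i j * g (i , j))
realise A = ⨁ λ i → ⨁ λ j → copies (A i j) (i , j)

module MultipartiteGraph {n r t : ℕ} (A : Matrix r t) (rows : ∀ i → rowSum A i ≡ n) where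

  order : ℕ
  order = size (realise A)

  part : Fin order → Fin r
  part = proj₁ ∘ label (realise A)

  colour : Fin order → Fin t
  colour = proj₂ ∘ label (realise A)

  open Labelling part colour public

  incidence≡ : ∀ i j → incidence i j ≡ A i j
  incidence≡ i j = begin
    incidence i j
      -- The functional is evaluated at the indicator of the label (i , j).
      ≡⟨ Σ-label (realise A) (λ (i′ , j′) → ⟦ i′ ≟ᶠ i ⟧ * ⟦ j′ ≟ᶠ j ⟧) ⟩
    Σᶠ (λ i′ → Σᶠ λ j′ → A i′ j′ * (⟦ i′ ≟ᶠ i ⟧ * ⟦ j′ ≟ᶠ j ⟧))
      ≡⟨ (sum-cong-≗ λ i′ → Σ-single j (off₂ i′)) ⟩
    Σᶠ (λ i′ → A i′ j * (⟦ i′ ≟ᶠ i ⟧ * ⟦ j ≟ᶠ j ⟧))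
      ≡⟨ Σ-single i off₁ ⟩
    A i j * (⟦ i ≟ᶠ i ⟧ * ⟦ j ≟ᶠ j ⟧)
      ≡⟨ cong₂ (λ x y → A i j * (x * y)) (on i) (on j) ⟩
    A i j * 1
      ≡⟨ *-identityʳ (A i j) ⟩
    A i j ∎
    where
    open ≡-Reasoning
    ⟦≢⟧ : ∀ {k} {x y : Fin k} → x ≢ y → ⟦ x ≟ᶠ y ⟧ ≡ 0
    ⟦≢⟧ {x = x} {y} x≢y with x ≟ᶠ y
    ... | yes x≡y = contradiction x≡y x≢y
    ... | no _ = refl
    on : ∀ {k} (x : Fin k) → ⟦ x ≟ᶠ x ⟧ ≡ 1
    on x with x ≟ᶠ x
    ... | yes _ = refl
    ... | no x≢x = contradiction refl x≢x
    off₁ : ∀ i′ → i′ ≢ i → A i′ j * (⟦ i′ ≟ᶠ i ⟧ * ⟦ j ≟ᶠ j ⟧) ≡ 0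
    off₁ i′ i′≢i rewrite ⟦≢⟧ i′≢i = *-zeroʳ (A i′ j)
    off₂ : ∀ i′ j′ → j′ ≢ j → A i′ j′ * (⟦ i′ ≟ᶠ i ⟧ * ⟦ j′ ≟ᶠ j ⟧) ≡ 0
    off₂ i′ j′ j′≢j rewrite ⟦≢⟧ j′≢j | *-zeroʳ ⟦ i′ ≟ᶠ i ⟧ = *-zeroʳ (A i′ j′)

  part-size : ∀ i → Σᶠ (λ v → ⟦ part v ≟ᶠ i ⟧) ≡ n
  part-size i = trans (sym (incidence-rowSum i)) (trans (sum-cong-≗ (incidence≡ i)) (rows i))

  graph : SimpleGraph order
  graph = record
    -- `v` is put first so that the decision of `u ~ v` is literally the summand of
    -- `farDegree (part u) (colour u)`.
    { _~_    = λ u v → part v ≢ part u × colour v ≢ colour u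
    ; _~?_   = λ u v → ¬? (part v ≟ᶠ part u) ×-dec ¬? (colour v ≟ᶠ colour u)
    ; sym    = λ (p , q) → p ∘ sym , q ∘ sym
    ; irrefl = λ { refl (p≢p , _) → p≢p refl }
    }

  partiteGraph : BalancedPartiteGraph r n
  partiteGraph = record
    { order       = order
    ; graph       = graph
    ; part        = part
    ; part-size   = λ i → trans (count-tabulate (λ v → part v ≟ᶠ i) id) (part-size i)
    ; independent = λ p (q , _) → q (sym p)
    }

  open BalancedPartiteGraph partiteGraph using (degree; IsMinDegree; IsChromaticNumber)

  chromatic : ∃ λ χ → IsChromaticNumber χ × χ ≤ t
  chromatic = minimum-exists (colourable? graph) t (colour , λ (_ , q) eq → q (sym eq))

  degree+columnSum : ∀ v → degree v + n + columnSum A (colour v) ≡ r * n + A (part v) (colour v)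
  degree+columnSum v = begin
    degree v + n + columnSum A (colour v)
      ≡⟨ cong₂ (λ x y → x + n + y) (count-tabulate (SimpleGraph._~?_ graph v) id) (sum-cong-≗ λ i → sym (incidence≡ i (colour v))) ⟩
    farDegree (part v) (colour v) + n + columnSum incidence (colour v)
      ≡⟨ farDegree+columnSum part-size (part v) (colour v) ⟩
    r * n + incidence (part v) (colour v)
      ≡⟨ cong (_+_ (r * n)) (incidence≡ (part v) (colour v)) ⟩
    r * n + A (part v) (colour v) ∎
    where open ≡-Reasoning

  -- A vertex of part i and colour j has degree (r - 1) n - (c_j - a_ij). The entry attaining D is
  -- positive, so it belongs to a vertex, and `Bounded` at all other vertices makes that degree
  -- least.
  minDegree-exists : ∀ {D} → IsD A D → ∃ λ k → IsMinDegree k × k + n + D ≡ r * n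
  minDegree-exists {D} isD@((i , j , Aij>0 , D≡) , _)
    with incidence>0⇒∃ (subst (0 <_) (sym (incidence≡ i j)) Aij>0)
  ... | v , refl , refl = degree v , ((v , refl) , λ { (w , refl) → least w }) , total
    where
    open ≤-Reasoning
    total : degree v + n + D ≡ r * n
    total = +-cancelʳ-≡ (A i j) _ _ (begin-equality
      degree v + n + D + A i j                        ≡⟨ +-assoc (degree v + n) D (A i j) ⟩
      degree v + n + (D + A i j)                      ≡⟨ cong (λ x → degree v + n + (x + A i j)) D≡ ⟨
      degree v + n + (columnSum A j ∸ A i j + A i j)  ≡⟨ cong (_+_ (degree v + n)) (m∸n+n≡m (f≤Σ (λ i → A i j) i)) ⟩
      degree v + n + columnSum A j                    ≡⟨ degree+columnSum v ⟩
      r * n + A i j                                   ∎)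
    least : ∀ w → degree v ≤ degree w
    least w = +-cancelʳ-≤ n _ _ (+-cancelʳ-≤ (D + a) _ _ (begin
      degree v + n + (D + a)                  ≡⟨ +-assoc (degree v + n) D a ⟨
      degree v + n + D + a                    ≡⟨ cong (_+ a) total ⟩
      r * n + a                               ≡⟨ degree+columnSum w ⟨
      degree w + n + columnSum A (colour w)   ≤⟨ +-monoʳ-≤ (degree w + n) (IsD⇒Bounded A isD (part w) (colour w) a>0) ⟩
      degree w + n + (D + a)                  ∎))
      where
      a : ℕ
      a = A (part w) (colour w)
      a>0 : 0 < a
      a>0 = subst (0 <_) (incidence≡ (part w) (colour w)) (incidence-self w)

module _ {n r t D : ℕ} (1≤r : 1 ≤ r) (1≤n : 1 ≤ n) (optimal : Optimal n r t D) where

  -- The matrix counting parts against colours has D(A) ≥ D by optimality; a vertex at an entry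
  -- attaining D(A) has degree at most its `farDegree`.
  minDegree≤ : (G : BalancedPartiteGraph r n) → BalancedPartiteGraph.Colourable G t →
               ∀ {k} → BalancedPartiteGraph.IsMinDegree G k → k + n + D ≤ r * n
  minDegree≤ G (colour , proper) {k} (_ , k≤degree) = bound (D-exists incidence 1≤r 1≤n rows)
    where
    open BalancedPartiteGraph G using (part; part-size; independent; degree; _~?_)
    open Labelling part colour
    sizes : ∀ i → Σᶠ (λ v → ⟦ part v ≟ᶠ i ⟧) ≡ n
    sizes i = trans (sym (count-tabulate (λ v → part v ≟ᶠ i) id)) (part-size i)
    rows : ∀ i → rowSum incidence i ≡ n
    rows i = trans (incidence-rowSum i) (sizes i)
    degree≤ : ∀ v → degree v ≤ farDegree (part v) (colour v)
    degree≤ v = ≤-trans (≤-reflexive (count-tabulate (v ~?_) id)) (Σ-mono-≤ λ w →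
      ⟦⟧-mono (v ~? w) (¬? (part w ≟ᶠ part v) ×-dec ¬? (colour w ≟ᶠ colour v))
        λ v~w → (λ eq → independent (sym eq) v~w) , (λ eq → proper v~w (sym eq)))
    bound : ∃ (IsD incidence) → k + n + D ≤ r * n
    bound (D′ , isD@((i , j , p , D′≡) , _)) with incidence>0⇒∃ p
    ... | v , refl , refl = +-cancelʳ-≤ (incidence i j) _ _ (begin
      k + n + D + incidence i j
        ≤⟨ +-monoˡ-≤ (incidence i j) (+-mono-≤ (+-monoˡ-≤ n (≤-trans (k≤degree (v , refl)) (degree≤ v)))
             (subst (D ≤_) (sym D′≡) (Optimal.least optimal incidence rows (IsD⇒Bounded incidence isD)))) ⟩
      farDegree i j + n + (columnSum incidence j ∸ incidence i j) + incidence i j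
        ≡⟨ +-assoc (farDegree i j + n) _ _ ⟩
      farDegree i j + n + (columnSum incidence j ∸ incidence i j + incidence i j)
        ≡⟨ cong (_+_ (farDegree i j + n)) (m∸n+n≡m (f≤Σ (λ i → incidence i j) i)) ⟩
      farDegree i j + n + columnSum incidence j
        ≡⟨ farDegree+columnSum sizes i j ⟩
      r * n + incidence i j ∎)
      where open ≤-Reasoning

  optimal⇒IsMaxMinDegree : ∃ λ k → IsMaxMinDegree n r t k × k + n + D ≡ r * n
  optimal⇒IsMaxMinDegree with optimal-matrix 1≤r 1≤n optimal
  ... | A , rows , isD with MultipartiteGraph.minDegree-exists A rows isD
  ...   | k , isMinDegree , k≡ = k , ((partiteGraph , chromatic , isMinDegree) , greatest) , k≡
    where
    open MultipartiteGraph A rows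
    greatest : ∀ {j} → (Σ[ G ∈ BalancedPartiteGraph r n ]
                 (∃ λ χ → BalancedPartiteGraph.IsChromaticNumber G χ × χ ≤ t)
                 × BalancedPartiteGraph.IsMinDegree G j) → j ≤ k
    greatest (G , (χ , ((c , proper) , _) , χ≤t) , isMin) = +-cancelʳ-≤ n _ _ (+-cancelʳ-≤ D _ _ (≤-trans
      (minDegree≤ G ((λ v → inject≤ (c v) χ≤t) , λ u~v eq → proper u~v (inject≤-injective χ≤t χ≤t _ _ eq)) isMin)
      (≤-reflexive (sym k≡))))

-- The value of the minimum

if-dec : ∀ {a b p} {A : Set a} {P : Set p} (P? : Dec P) (Q : A → Set b) {x y : A} →
         (P → Q x) → (¬ P → Q y) → Q (if does P? then x else y)
if-dec (yes p) Q f g = f p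
if-dec (no ¬p) Q f g = g ¬p

-- `Parameters.ε` with its data as arguments, so that computed values can be substituted.
ε-value : (H T n-s : ℤ) → ℤ
ε-value H T n-s =
  if does (H ℤ.<? 0ℤ) then 1ℤ else
  if does ((H ℤ.≟ 0ℤ) ×-dec ¬? (n-s Signed.∣? T)) then 1ℤ else
  0ℤ

module Minimum (β c p : ℕ) {n s T : ℕ} (1≤n : 1 ≤ n)
  (T<M : T < Arithmetic.M (β + p) β c) where

  open Arithmetic (β + p) β c
  open Estimates n s T 1≤n T<M

  private
    d H₊ H₋ : ℕ
    d = M * s + T
    H₊ = t * d + τ * s
    H₋ = R * n

  -- `s` and `T` are quantified afresh so that d + 1 is covered too. Taking h = 1 and g = T needs s
  -- < n, which T > 0 provides; for T = 0 nothing is raised.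
  matrix-if-H>0 : ∀ s T → M * s + T ≤ M * n → H₋ < t * (M * s + T) + τ * s → T < M →
                  ∃ λ (A : Matrix (suc R) t) → (∀ i → rowSum A i ≡ n) × Bounded A (M * s + T)
  matrix-if-H>0 s zero d≤Mn H>0 _ = UpperBound.bounded-matrix β c p {n} {s} {0} {0} {0} refl z≤n
    (subst (_≤ n) (sym (+-identityʳ s)) (*-cancelˡ-≤ M (≤-trans (m≤m+n (M * s) 0) d≤Mn))) (<⇒≤ H>0) (inj₁ (<⇒≤ H>0))
  matrix-if-H>0 s T@(suc _) d≤Mn H>0 T<M = UpperBound.bounded-matrix β c p {n} {s} {T} {1} {T} (*-identityʳ T) (m≤n⇒m≤1+n (<⇒≤ T<M))
    (subst (_≤ n) (+-comm 1 s) (*-cancelˡ-< M _ _ (<-≤-trans (m<m+n (M * s) z<s) d≤Mn))) (<⇒≤ H>0) (inj₁ H>0)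

  module _ (lo : M * R * n ≤ d * K) (least : ∀ D → M * R * n ≤ D * K → d ≤ D) where

    d≤bound : ∀ (A : Matrix (suc R) t) → (∀ i → rowSum A i ≡ n) → ∀ {D} → Bounded A D → d ≤ D
    d≤bound A rows {D} bounded = least D (LowerBound.MRn≤DK (β + p) β c 1≤n A rows bounded)

    d≤Mn : d ≤ M * n
    d≤Mn = least (M * n) (single-bound n (M * n) ≤-refl)

    optimal-if-H>0 : H₋ < H₊ → Optimal n (suc R) t d
    optimal-if-H>0 H>0 = record { attained = matrix-if-H>0 s T d≤Mn H>0 T<M ; least = d≤bound }

    module _ (H≤0 : H₊ ≤ H₋) where

      d<Mn : d < M * n
      d<Mn = ≰⇒> λ Mn≤d → <⇒≱ (Mn≤d⇒H>0 Mn≤d) H≤0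

      s<n : s < n
      s<n = *-cancelˡ-< M _ _ (≤-<-trans (m≤m+n (M * s) T) d<Mn)

      -- H becomes positive at d + 1 by `H₊<H₋+t`. The remainder T grows by one, or from M - 1 it
      -- carries over into s.
      matrix-for-d+1 : ∃ λ (A : Matrix (suc R) t) → (∀ i → rowSum A i ≡ n) × Bounded A (suc d)
      matrix-for-d+1 with suc T <? M
      ... | yes 1+T<M = subst (λ D → ∃ λ (A : Matrix (suc R) t) → (∀ i → rowSum A i ≡ n) × Bounded A D) d+1≡
              (matrix-if-H>0 s (suc T) (subst (_≤ M * n) (sym d+1≡) d<Mn) (subst (λ D → H₋ < t * D + τ * s) (sym d+1≡) (H₊<H₋+t lo)) 1+T<M)
        where
        d+1≡ : M * s + suc T ≡ suc d
        d+1≡ = +-suc (M * s) T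
      ... | no 1+T≮M = subst (λ D → ∃ λ (A : Matrix (suc R) t) → (∀ i → rowSum A i ≡ n) × Bounded A D) d+1≡
              (matrix-if-H>0 (suc s) 0 (subst (_≤ M * n) (sym d+1≡) d<Mn)
                (<-≤-trans (H₊<H₋+t lo) (+-mono-≤ (*-monoʳ-≤ t (≤-reflexive (sym d+1≡))) (*-monoʳ-≤ τ (n≤1+n s)))) z<s)
        where
        d+1≡ : M * suc s + 0 ≡ suc d
        d+1≡ = trans (+-identityʳ (M * suc s)) (trans (*-suc M s) (trans (+-comm M (M * s))
          (trans (cong (λ x → M * s + x) (sym (≤-antisym T<M (≮⇒≥ 1+T≮M)))) (+-suc (M * s) T))))

      optimal-d+1 : (H₊ ≡ H₋ → ¬ (n ∸ s) ∣ T) → Optimal n (suc R) t (suc d)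
      optimal-d+1 n∸s∤T = record { attained = matrix-for-d+1 ; least = λ A rows bounded →
        ≤∧≢⇒< (d≤bound A rows bounded) λ { refl → obstruction A rows bounded } }
        where
        obstruction : ∀ A → (∀ i → rowSum A i ≡ n) → ¬ Bounded A d
        obstruction A rows bounded = n∸s∤T H≡0 (LowerBound.n∸s∣T (β + p) β c 1≤n A rows T<M bounded H≡0 s<n)
          where
          H≡0 : H₊ ≡ H₋
          H≡0 = ≤-antisym H≤0 (LowerBound.H≥0 (β + p) β c 1≤n A rows T<M bounded)

    optimal-if-H≡0 : H₊ ≡ H₋ → (n ∸ s) ∣ T → Optimal n (suc R) t d
    optimal-if-H≡0 H≡0 (divides q T≡) = record { attained = matrix ; least = d≤bound }
      where
      s≤n : s ≤ n
      s≤n = <⇒≤ (s<n (≤-reflexive H≡0))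
      s+[n∸s]≡n : s + (n ∸ s) ≡ n
      s+[n∸s]≡n = m+[n∸m]≡n s≤n
      q≤T : q ≤ T
      -- As n - s ≥ 1, the number q of raised entries is at most T, so it fits into a column of m
      -- rows.
      q≤T = subst₂ _≤_ (*-identityʳ q) (sym T≡) (*-monoʳ-≤ q (m<n⇒0<n∸m (s<n (≤-reflexive H≡0))))
      matrix : ∃ λ (A : Matrix (suc R) t) → (∀ i → rowSum A i ≡ n) × Bounded A d
      matrix = UpperBound.bounded-matrix β c p {n} {s} {T} {n ∸ s} {q} (sym T≡) (m≤n⇒m≤1+n (≤-trans q≤T (<⇒≤ T<M)))
        (≤-reflexive s+[n∸s]≡n) (≤-reflexive (sym H≡0)) (inj₂ s+[n∸s]≡n)

    optimum : ∃ λ D → Optimal n (suc R) t D × + D ≡ + d ℤ.+ ε-value (+ H₊ ℤ.- + H₋) (+ T) (+ n ℤ.- + s)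
    optimum = if-dec (H ℤ.<? 0ℤ) Q
      (λ H<0 → let H₊<H₋ = H<0⇒H₊<H₋ H<0 in
        larger (<⇒≤ H₊<H₋) λ H≡0 → contradiction H≡0 (<⇒≢ H₊<H₋))
      λ H≮0 → if-dec ((H ℤ.≟ 0ℤ) ×-dec ¬? ((+ n ℤ.- + s) Signed.∣? + T)) Q
        (λ (H≡0 , n-s∤T) → let H≤0 = ≤-reflexive (H≡0⇒H₊≡H₋ H≡0) in
          larger H≤0 λ _ n∸s∣T → n-s∤T (subst (Signed._∣ + T) (sym (n-s≡ H≤0)) (∣ᵤ⇒∣ n∸s∣T)))
        -- The last branch only denies that H = 0 and n - s ∤ T hold together; decidability of
        -- divisibility recovers n - s ∣ T.
        λ ¬H≡0∧∤ → exact (H≮0⇒H₋≤H₊ H≮0) λ H₊≡H₋ → decidable-stable (n ∸ s ∣? T) λ n∸s∤T →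
          ¬H≡0∧∤ (ℤ.i≡j⇒i-j≡0 (cong +_ H₊≡H₋) , λ n-s∣T →
            n∸s∤T (∣⇒∣ᵤ (subst (Signed._∣ + T) (n-s≡ (≤-reflexive H₊≡H₋)) n-s∣T)))
      where
      H : ℤ
      H = + H₊ ℤ.- + H₋
      Q : ℤ → Set
      Q ε = ∃ λ D → Optimal n (suc R) t D × + D ≡ + d ℤ.+ ε
      larger : H₊ ≤ H₋ → (H₊ ≡ H₋ → ¬ (n ∸ s) ∣ T) → Q 1ℤ
      larger H≤0 n∸s∤T = suc d , optimal-d+1 H≤0 n∸s∤T , cong +_ (+-comm 1 d)
      exact : H₋ ≤ H₊ → (H₊ ≡ H₋ → (n ∸ s) ∣ T) → Q 0ℤ
      exact H≥0 n∸s∣T with H₋ ≟ H₊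
      ... | no H₋≢H₊ = d , optimal-if-H>0 (≤∧≢⇒< H≥0 H₋≢H₊) , sym (ℤ.+-identityʳ (+ d))
      ... | yes H₋≡H₊ = d , optimal-if-H≡0 (sym H₋≡H₊) (n∸s∣T (sym H₋≡H₊)) , sym (ℤ.+-identityʳ (+ d))
      H<0⇒H₊<H₋ : H ℤ.< 0ℤ → H₊ < H₋
      H<0⇒H₊<H₋ H<0 = ≰⇒> λ H₋≤H₊ → ℤ.<⇒≱ H<0 (ℤ.i≤j⇒0≤j-i (+≤+ H₋≤H₊))
      H≡0⇒H₊≡H₋ : H ≡ 0ℤ → H₊ ≡ H₋
      H≡0⇒H₊≡H₋ H≡0 = ℤ.+-injective (ℤ.i-j≡0⇒i≡j (+ H₊) (+ H₋) H≡0)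
      H≮0⇒H₋≤H₊ : ¬ (H ℤ.< 0ℤ) → H₋ ≤ H₊
      H≮0⇒H₋≤H₊ H≮0 = ℤ.drop‿+≤+ (ℤ.0≤i-j⇒j≤i (ℤ.≮⇒≥ H≮0))
      -- Truncated subtraction is exact here because H ≤ 0 implies s < n; divisibility is compared
      -- only in that range.
      n-s≡ : H₊ ≤ H₋ → + n ℤ.- + s ≡ + (n ∸ s)
      n-s≡ H≤0 = trans (ℤ.m-n≡m⊖n n s) (ℤ.⊖-≥ (<⇒≤ (s<n H≤0)))

  optimum-for : ∀ {d} → M * s + T ≡ d → M * R * n ≤ d * K → (∀ D → M * R * n ≤ D * K → d ≤ D) →
                ∃ λ D → Optimal n (suc R) t D ×
                  + D ≡ + d ℤ.+ ε-value (+ (t * d + τ * s) ℤ.- + H₋) (+ T) (+ n ℤ.- + s)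
  optimum-for refl = optimum

-- Floors, ceilings and the integer formulas

floor-/ : ∀ x y .{{_ : NonZero y}} → floor (+ x /ᵘ y) ≡ + (x / y)
floor-/ x (suc y) = ℤ.div-pos-is-/ℕ (+ x) (suc y)

ceiling-/ : ∀ x y .{{_ : NonZero y}} →
            ∃ λ d → ceiling (+ x /ᵘ y) ≡ + d × x ≤ d * y × (∀ D → x ≤ D * y → d ≤ D)
ceiling-/ x y@(suc _) = nonNegative z refl above
  where
  open ℤ.≤-Reasoning
  q z : ℤ
  q = (ℤ.- + x) ℤ./ + y
  z = ℤ.- q
  above : + x ℤ.≤ z ℤ.* + y
  above = begin
    + x                  ≡⟨ ℤ.neg-involutive (+ x) ⟨
    ℤ.- (ℤ.- + x)        ≤⟨ ℤ.neg-mono-≤ (ℤ.[n/d]*d≤n (ℤ.- + x) (+ y)) ⟩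
    ℤ.- (q ℤ.* + y)      ≡⟨ ℤ.neg-distribˡ-* q (+ y) ⟩
    z ℤ.* + y            ∎
  below : z ℤ.* + y ℤ.< + x ℤ.+ + y
  below = begin-strict
    z ℤ.* + y                                ≡⟨ eq q (+ x) (+ y) ⟩
    (ℤ.- + x) ℤ.+ (+ x ℤ.- q ℤ.* + y)        <⟨ ℤ.+-monoˡ-< (+ x ℤ.- q ℤ.* + y) (subst (λ v → ℤ.- + x ℤ.< ℤ.suc v ℤ.* + y) (sym (ℤ.div-pos-is-/ℕ (ℤ.- + x) y)) (ℤ.n<s[n/ℕd]*d (ℤ.- + x) y)) ⟩
    ℤ.suc q ℤ.* + y ℤ.+ (+ x ℤ.- q ℤ.* + y)  ≡⟨ eq′ q (+ x) (+ y) ⟩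
    + x ℤ.+ + y                              ∎
    where
    eq : ∀ q x y → (ℤ.- q) ℤ.* y ≡ (ℤ.- x) ℤ.+ (x ℤ.- q ℤ.* y)
    eq = ℤ-solve-∀
    eq′ : ∀ q x y → (1ℤ ℤ.+ q) ℤ.* y ℤ.+ (x ℤ.- q ℤ.* y) ≡ x ℤ.+ y
    eq′ = ℤ-solve-∀
  -- The ceiling is -⌊-x / y⌋, an integer `z`; x ≤ z y excludes negative values, and z y < x + y
  -- makes it least.
  nonNegative : ∀ w → z ≡ w → + x ℤ.≤ w ℤ.* + y →
                ∃ λ d → z ≡ + d × x ≤ d * y × (∀ D → x ≤ D * y → d ≤ D)
  nonNegative (+ d) z≡d x≤dy = d , z≡d , ℤ.drop‿+≤+ (subst (+ x ℤ.≤_) (sym (ℤ.pos-* d y)) x≤dy) , λ D x≤Dy →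
    s≤s⁻¹ (*-cancelʳ-< y d (suc D) (bound D x≤Dy))
    where
    bound : ∀ D → x ≤ D * y → d * y < suc D * y
    bound D x≤Dy = <-≤-trans
      (ℤ.drop‿+<+ (subst (ℤ._< + (x + y)) (trans (cong (ℤ._* + y) z≡d) (sym (ℤ.pos-* d y))) below))
      (≤-trans (+-monoˡ-≤ y x≤Dy) (≤-reflexive (+-comm (D * y) y)))
  nonNegative -[1+ _ ] _ ()

-- The integer quantities are variables tied by equations, so matching on `refl` replaces them
-- everywhere at once, also inside ε.
conclusion : ∀ {n r N t d s T H} {dℤ sℤ Tℤ Hℤ : ℤ} → 1 ≤ n →
  dℤ ≡ + d → sℤ ≡ + s → Tℤ ≡ + T → Hℤ ≡ H → T ≤ N →
  (∃ λ D → Optimal n (suc r) t D × + D ≡ + d ℤ.+ ε-value H (+ T) (+ n ℤ.- + s)) →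
  let ε = ε-value Hℤ Tℤ (+ n ℤ.- sℤ) in
  (0ℤ ℤ.≤ Tℤ × Tℤ ℤ.≤ + N)
    × (Σ[ k ∈ ℕ ] IsMaxMinDegree n (suc r) t k × + k ≡ + r ℤ.* + n ℤ.- dℤ ℤ.- ε)
    × (Σ[ k ∈ ℕ ] IsMinD n (suc r) t k × + k ≡ dℤ ℤ.+ ε)
conclusion {n} {r} {N} {t} {d} {s} {T} {H} 1≤n refl refl refl refl T≤N (D , optimal , D≡) =
  (+≤+ z≤n , +≤+ T≤N) , maxMinDegree (optimal⇒IsMaxMinDegree (s≤s z≤n) 1≤n optimal) ,
  (D , optimal⇒IsMinD (s≤s z≤n) 1≤n optimal , D≡)
  where
  open ≡-Reasoning
  ε : ℤ
  ε = ε-value H (+ T) (+ n ℤ.- + s)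
  maxMinDegree : (∃ λ k → IsMaxMinDegree n (suc r) t k × k + n + D ≡ suc r * n) →
                 Σ[ k ∈ ℕ ] IsMaxMinDegree n (suc r) t k × + k ≡ + r ℤ.* + n ℤ.- + d ℤ.- ε
  maxMinDegree (k , isMax , k+n+D≡) = k , isMax , (begin
    + k                                   ≡⟨ eq (+ k) (+ d) ε ⟩
    + k ℤ.+ (+ d ℤ.+ ε) ℤ.- + d ℤ.- ε     ≡⟨ cong (λ x → + k ℤ.+ x ℤ.- + d ℤ.- ε) D≡ ⟨
    + k ℤ.+ + D ℤ.- + d ℤ.- ε             ≡⟨ cong (λ x → x ℤ.- + d ℤ.- ε) (trans (sym (ℤ.pos-+ k D)) (trans (cong +_ k+D≡) (ℤ.pos-* r n))) ⟩
    + r ℤ.* + n ℤ.- + d ℤ.- ε             ∎)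
    where
    eq : ∀ k d ε → k ≡ k ℤ.+ (d ℤ.+ ε) ℤ.- d ℤ.- ε
    eq = ℤ-solve-∀
    eq′ : ∀ k n D → n + (k + D) ≡ k + n + D
    eq′ = solve-∀
    k+D≡ : k + D ≡ r * n
    k+D≡ = +-cancelˡ-≡ n _ _ (trans (eq′ k n D) k+n+D≡)

T-value : ∀ {d} M s T → d ≡ M * s + T → + d ℤ.- + M ℤ.* + s ≡ + T
T-value M s T refl = begin
  + (M * s + T) ℤ.- + M ℤ.* + s         ≡⟨ cong (ℤ._- + M ℤ.* + s) (trans (ℤ.pos-+ (M * s) T) (cong (ℤ._+ + T) (ℤ.pos-* M s))) ⟩
  + M ℤ.* + s ℤ.+ + T ℤ.- + M ℤ.* + s   ≡⟨ eq (+ M ℤ.* + s) (+ T) ⟩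
  + T                                   ∎
  where
  open ≡-Reasoning
  eq : ∀ x y → x ℤ.+ y ℤ.- x ≡ y
  eq = ℤ-solve-∀

H-value : ∀ n t d τ s R → + n ℤ.+ + t ℤ.* + d ℤ.+ + τ ℤ.* + s ℤ.- + suc R ℤ.* + n ≡ + (t * d + τ * s) ℤ.- + (R * n)
H-value n t d τ s R = begin
  + n ℤ.+ + t ℤ.* + d ℤ.+ + τ ℤ.* + s ℤ.- + suc R ℤ.* + n
    ≡⟨ eq (+ n) (+ t) (+ d) (+ τ) (+ s) (+ R) ⟩
  (+ t ℤ.* + d ℤ.+ + τ ℤ.* + s) ℤ.- + R ℤ.* + n
    ≡⟨ cong₂ ℤ._-_ (cong₂ ℤ._+_ (ℤ.pos-* t d) (ℤ.pos-* τ s)) (ℤ.pos-* R n) ⟨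
  + (t * d + τ * s) ℤ.- + (R * n) ∎
  where
  open ≡-Reasoning
  eq : ∀ n t d τ s R → n ℤ.+ t ℤ.* d ℤ.+ τ ℤ.* s ℤ.- (1ℤ ℤ.+ R) ℤ.* n ≡ (t ℤ.* d ℤ.+ τ ℤ.* s) ℤ.- R ℤ.* n
  eq = ℤ-solve-∀

theorem3p1 : (n m t a r : ℕ) →
    1 ≤ n → (2≤m : 2 ≤ m) (3≤t : 3 ≤ t) →
    2 ≤ a → a ≤ m ⊓ (t ∸ 1) →
    r ≡ m * t ∸ a →
    let open Parameters n r 2≤m 3≤t in
    (0ℤ ℤ.≤ T × T ℤ.≤ + m ℤ.- + 2)
    × (Σ[ k ∈ ℕ ] IsMaxMinDegree n r t k × + k ≡ (+ r ℤ.- 1ℤ) ℤ.* + n ℤ.- d ℤ.- ε)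
    × (Σ[ k ∈ ℕ ] IsMinD n r t k × + k ≡ d ℤ.+ ε)
theorem3p1 _ (suc zero) _ _ _ _ (s≤s ()) _ _ _ _
theorem3p1 _ (suc (suc _)) (suc zero) _ _ _ _ (s≤s ()) _ _ _
theorem3p1 _ (suc (suc _)) (suc (suc zero)) _ _ _ _ (s≤s (s≤s ())) _ _ _
theorem3p1 _ (suc (suc _)) (suc (suc (suc _))) (suc zero) _ _ _ _ (s≤s ()) _ _
theorem3p1 n (suc (suc N)) (suc (suc (suc u))) (suc (suc β)) r 1≤n 2≤m 3≤t _ a≤ r≡ =
  -- a ≤ m and a ≤ t - 1 become β ≤ N and β ≤ u; the differences are p = m - a and c = t - 1 - a.
  reparametrise (m≤n⇒∃[o]m+o≡n (s≤s⁻¹ (s≤s⁻¹ (m≤n⊓o⇒m≤n _ _ a≤))))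
                (m≤n⇒∃[o]m+o≡n (s≤s⁻¹ (s≤s⁻¹ (m≤n⊓o⇒m≤o (suc (suc N)) _ a≤)))) 2≤m 3≤t r≡
  where
  Claim : ∀ N u r → 2 ≤ 2 + N → 3 ≤ 3 + u → Set₁
  Claim N u r 2≤m 3≤t = let open Parameters n r 2≤m 3≤t in
    (0ℤ ℤ.≤ T × T ℤ.≤ + N)
    × (Σ[ k ∈ ℕ ] IsMaxMinDegree n r (3 + u) k × + k ≡ (+ r ℤ.- 1ℤ) ℤ.* + n ℤ.- d ℤ.- ε)
    × (Σ[ k ∈ ℕ ] IsMinD n r (3 + u) k × + k ≡ d ℤ.+ ε)

  claim : ∀ c p (2≤m : 2 ≤ 2 + (β + p)) (3≤t : 3 ≤ 3 + (β + c)) →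
          let R = Arithmetic.R (β + p) β c in Claim (β + p) (β + c) (suc R) 2≤m 3≤t
  claim c p 2≤m 3≤t = withCeiling (ceiling-/ (M * R * n) (τ + M * t))
    where
    open Arithmetic (β + p) β c
    module P = Parameters n (suc R) 2≤m 3≤t
    numerator≡ : + M ℤ.* + R ℤ.* + n ≡ + (M * R * n)
    numerator≡ = trans (cong (ℤ._* + n) (sym (ℤ.pos-* M R))) (sym (ℤ.pos-* (M * R) n))
    -- `m * t ∸ 2` computes to `τ + M * t`, with the summands in this order.
    K≡ : τ + M * t ≡ K
    K≡ = +-comm τ (M * t)
    withCeiling : (∃ λ d → ceiling (+ (M * R * n) /ᵘ (τ + M * t)) ≡ + d ×
                    M * R * n ≤ d * (τ + M * t) × (∀ D → M * R * n ≤ D * (τ + M * t) → d ≤ D)) →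
                  Claim (β + p) (β + c) (suc R) 2≤m 3≤t
    withCeiling (d , ceiling≡d , lo , least) =
      conclusion 1≤n d≡ s≡
        (trans (cong₂ (λ x y → x ℤ.- + M ℤ.* y) d≡ s≡) (T-value M (d / M) (d % M) d≡Ms+T))
        (trans (cong₂ (λ x y → + n ℤ.+ + t ℤ.* x ℤ.+ + τ ℤ.* y ℤ.- + suc R ℤ.* + n) d≡ s≡) (H-value n t d τ (d / M) R))
        (s≤s⁻¹ (m%n<n d M))
        (Minimum.optimum-for β c p 1≤n (m%n<n d M) (sym d≡Ms+T)
          (subst (λ y → M * R * n ≤ d * y) K≡ lo)
          (λ D h → least D (subst (λ y → M * R * n ≤ D * y) (sym K≡) h)))
      where
      d≡ : P.d ≡ + d
      d≡ = trans (cong (λ x → ceiling (x /ᵘ (τ + M * t))) numerator≡) ceiling≡d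
      s≡ : P.s ≡ + (d / M)
      s≡ = trans (cong (λ x → floor (x /ᵘ M)) d≡) (floor-/ d M)
      d≡Ms+T : d ≡ M * (d / M) + d % M
      d≡Ms+T = trans (m≡m%n+[m/n]*n d M) (trans (+-comm (d % M) (d / M * M)) (cong (_+ d % M) (*-comm (d / M) M)))

  reparametrise : ∀ {N u r} → (∃ λ p → β + p ≡ N) → (∃ λ c → β + c ≡ u) →
                  (2≤m : 2 ≤ 2 + N) (3≤t : 3 ≤ 3 + u) →
                  r ≡ (2 + N) * (3 + u) ∸ (2 + β) → Claim N u r 2≤m 3≤t
  reparametrise (p , refl) (c , refl) 2≤m 3≤t r≡ = substR (trans r≡ r≡suc-R)
    where
    open Arithmetic (β + p) β c
    r≡suc-R : suc (β + c + M * t) ∸ β ≡ suc R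
    r≡suc-R = trans (cong (_∸ β) (eq β c (M * t))) (m+n∸m≡n β (suc R))
      where
      eq : ∀ β c x → 1 + (β + c + x) ≡ β + (1 + (x + c))
      eq = solve-∀
    substR : ∀ {r} → r ≡ suc R → Claim (β + p) (β + c) r 2≤m 3≤t
    substR refl = claim c p 2≤m 3≤t
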